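{- Let $r\geq 3$ and $k\geq 2$ be integers. Let $c_1=128r^{2r+3}$ and $c_2=\log (64kr^{2r+2})$. If $G$ is an $n$-vertex linear $r$-graph with average degree $d(G)\geq c_1 k$, then $G$ contains linear cycles of $k$ consecutive even lengths, the shortest of which has length at most $$2\left\lceil \frac{\log n}{\log (d(G)/k)-c_2}\right\rceil .$$
   Context: All (hyper)graphs are finite. An $r$-graph is an $r$-uniform hypergraph. An $r$-graph is linear if any two distinct edges share at most one vertex. An $r$-uniform linear cycle of length $\ell\ge 3$ is an $r$-graph consisting of $\ell$ edges $e_1,\dots,e_\ell$ on $(r-1)\ell$ vertices such that $|e_i\cap e_j|=1$ if $j=i\pm 1$ (indices modulo $\ell$) and $|e_i\cap e_j|=0$ for all other $i\ne j$. The average degree $d(G)$ of an $n$-vertex $r$-graph is $r\,e(G)/n$, where $e(G)$ is the number of edges. "Linear cycles of $k$ consecutive even lengths" means linear cycles of lengths $a,a+2,\dots,a+2(k-1)$ for some even integer $a$. Logarithms are base $2$.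
   Formalization: The bound on the shortest length is asserted only when log(d(G)/k) − c_2 > 0; otherwise (possible for k ≥ 2r) the printed bound is undefined or nonpositive, hence false. Existence of the cycles is asserted for all d(G) ≥ c_1 k. -}

module Defs where

import Algebra.Definitions.RawSemiring
open import Data.Fin using (Fin; toℕ)
open import Data.Fin.Properties using (nonZeroIndex)
open import Data.Fin.Subset using (Subset; _∩_; ⋃; ∣_∣)
open import Data.Integer as ℤ using (ℤ; +_; -[1+_])
open import Data.List using (List; length; tabulate)
open import Data.List.Membership.Propositional using (_∈_)
open import Data.List.Relation.Unary.All using (All)
open import Data.List.Relation.Unary.Unique.Propositional using (Unique)
open import Data.Nat as ℕ using (ℕ; suc; NonZero)
open import Data.Nat.DivMod using (_%_)
open import Data.Product using (_×_; ∃-syntax)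
open import Data.Rational as ℚ using (ℚ; 0ℚ; ½; ↥_; ↧ₙ_; _/_)
open import Data.Sum using (_⊎_)
open import Relation.Binary.PropositionalEquality using (_≡_; _≢_)
open import Relation.Nullary using (¬_)

------------------------------------------------------------------------
-- Hypergraphs

record RGraph (r n : ℕ) : Set where
  field
    edges   : List (Subset n)
    unique  : Unique edges
    uniform : All (λ e → ∣ e ∣ ≡ r) edges

open RGraph public

Linear : ∀ {r n} → RGraph r n → Set
Linear G = ∀ {e f} → e ∈ edges G → f ∈ edges G → e ≢ f → ∣ e ∩ f ∣ ℕ.≤ 1

averageDegree : ∀ {r n} .{{_ : NonZero n}} → RGraph r n → ℚ
averageDegree {r} {n} G = + (r ℕ.* length (edges G)) / n

-- j = i + 1 modulo ℓ
Next : ∀ {ℓ} → Fin ℓ → Fin ℓ → Set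
Next {ℓ} i j = _%_ (suc (toℕ i)) ℓ {{nonZeroIndex i}} ≡ toℕ j

-- A subgraph of G that is an r-uniform linear cycle of length ℓ.  Its vertex
-- set is the union of its edges.  The vertex count is not redundant: for ℓ = 3
-- it excludes three edges through a common vertex.
record LinearCycle {r n : ℕ} (G : RGraph r n) (ℓ : ℕ) : Set where
  field
    3≤ℓ         : 3 ℕ.≤ ℓ
    edge        : Fin ℓ → Subset n
    edge∈       : ∀ i → edge i ∈ edges G
    vertexCount : ∣ ⋃ (tabulate edge) ∣ ≡ (r ℕ.∸ 1) ℕ.* ℓ
    consecutive : ∀ {i j} → Next i j ⊎ Next j i → ∣ edge i ∩ edge j ∣ ≡ 1
    disjoint    : ∀ {i j} → i ≢ j → ¬ (Next i j ⊎ Next j i) →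
                  ∣ edge i ∩ edge j ∣ ≡ 0

------------------------------------------------------------------------
-- Real numbers, given by their strict rational lower and upper bounds.
-- The Dedekind-cut axioms are not part of the record; they hold for every
-- number formed below within the domain stated for the operation.

record ℝ : Set₁ where
  field
    Lower : ℚ → Set  -- Lower p : p is less than the number
    Upper : ℚ → Set  -- Upper p : p is greater than the number

open ℝ public

infixr 8 _^_
_^_ : ℚ → ℕ → ℚ
_^_ = Algebra.Definitions.RawSemiring._^_ ℚ.+-*-rawSemiring

2^_ : ℤ → ℚ
2^ (+ m)    = (+ 2 / 1) ^ m
2^ -[1+ m ] = ½ ^ suc m

-- Base 2 logarithm of q > 0: a / b < log₂ q iff 2 ^ a < q ^ b, for b > 0.
log₂ : ℚ → ℝ
log₂ q .Lower p = 2^ (↥ p) ℚ.< q ^ (↧ₙ p)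
log₂ q .Upper p = q ^ (↧ₙ p) ℚ.< 2^ (↥ p)

infixl 6 _-ᴿ_
_-ᴿ_ : ℝ → ℝ → ℝ
(x -ᴿ y) .Lower p = ∃[ u ] ∃[ v ] Lower x u × Upper y v × p ℚ.≤ u ℚ.- v
(x -ᴿ y) .Upper p = ∃[ u ] ∃[ v ] Upper x u × Lower y v × u ℚ.- v ℚ.≤ p

-- Quotient x / y for y > 0.  For 0 < v < y < w, the bound p y ≤ u follows
-- from p v ≤ u and p w ≤ u whatever the sign of p; similarly for u ≤ p y.
infixl 7 _/ᴿ_
_/ᴿ_ : ℝ → ℝ → ℝ
(x /ᴿ y) .Lower p = ∃[ u ] ∃[ v ] ∃[ w ] Lower x u ×
  0ℚ ℚ.< v × Lower y v × Upper y w × p ℚ.* v ℚ.≤ u × p ℚ.* w ℚ.≤ u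
(x /ᴿ y) .Upper p = ∃[ u ] ∃[ v ] ∃[ w ] Upper x u ×
  0ℚ ℚ.< v × Lower y v × Upper y w × u ℚ.≤ p ℚ.* v × u ℚ.≤ p ℚ.* w

Positive : ℝ → Set
Positive x = Lower x 0ℚ

-- m = ⌈ x ⌉, that is, m - 1 < x ≤ m.
IsCeiling : ℝ → ℤ → Set
IsCeiling x m = Lower x ((m ℤ.- + 1) / 1) × ¬ Lower x (m / 1)

------------------------------------------------------------------------
-- Constants

c₁ : ℕ → ℕ
c₁ r = 128 ℕ.* r ℕ.^ (2 ℕ.* r ℕ.+ 3)

c₂ : ℕ → ℕ → ℝ
c₂ r k = log₂ (+ (64 ℕ.* k ℕ.* r ℕ.^ (2 ℕ.* r ℕ.+ 2)) / 1)

-- log (d(G) / k) - c₂.  It can be zero or negative when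
-- c₁ k ≤ d(G) ≤ 64 k² r ^ (2r + 2), which is possible for k ≥ 2r.
denominator : ∀ {r n} .{{_ : NonZero n}} → RGraph r n →
              (k : ℕ) .{{_ : NonZero k}} → ℝ
denominator {r} G k = log₂ (averageDegree G ℚ.* (+ 1 / k)) -ᴿ c₂ r k

{-# OPTIONS --safe #-}

-- After passing to a subhypergraph of large minimum degree, grow a linear hypertree level by
-- level from a root.  Each level is a maximal family of edges that have one vertex in the top of
-- the tree and are otherwise disjoint from it and from each other; of the new vertices of such
-- an edge only one of largest degree is extended further.  Hence the edges meeting older levels
-- are few, and every other edge at a top vertex v meets the current or the next level again, in
-- u say.  If these arcs v → u are few, the tops grow geometrically; as there are only n vertices,
-- this stops after about log n / log (d / k) levels.
--
-- At a level where the arcs are many, prune them to large minimum degree at tails and at heads.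
-- Among the pairs of arcs with a common head take tails y, y′ whose least common ancestor has
-- maximal height h, and from that head leave along a third arc, walking greedily along arcs.  All
-- tails z met on the way are within height h of y and y′, so by the ultrametric inequality one
-- of y, y′ is at height exactly h from z.  The tree path joining them closes the walk to a linear
-- cycle of length 2h + 2l, where 2l is the length of the walk, for every l = 1, …, k.

module Submission where

import Defs
open import Defs hiding (_^_)
open import Data.Bool using (Bool; true; false)
open import Data.Fin using (Fin; zero; suc; toℕ)
open import Data.Fin.Properties using (toℕ<n; toℕ-injective; _≟_)
open import Data.Fin.Subset as Subset using (Subset; _∪_; _∩_; ⋃; ⁅_⁆; ∣_∣; inside; outside)
  renaming (_∈_ to _∈ˢ_)
open import Data.Fin.Subset.Properties as Subsetₚ
  using (_∈?_; x∈p∩q⁺; x∈p∩q⁻; x∈p∪q⁺; x∈p∪q⁻; x∈⁅x⁆; x∈⁅y⁆⇒x≡y; ∣⁅x⁆∣≡1; ∩-comm)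
open import Data.List
  using (List; []; _∷_; _++_; length; lookup; tabulate; filter; map; allFin; cartesianProduct)
open import Data.Nat.ListAction using (sum)
open import Data.List.Membership.Propositional using (_∈_; find; lose)
open import Data.List.Membership.Propositional.Properties
  using (∈-filter⁺; ∈-filter⁻; ∈-∃++; ∈-++⁺ˡ; ∈-++⁺ʳ; ∈-++⁻; ∈-allFin; ∈-map⁺; ∈-map⁻;
         ∈-cartesianProduct⁺; ∈-cartesianProduct⁻)
open import Data.List.Properties
  using (length-++; length-map; length-tabulate; map-++; filter-none; filter-some;
         tabulate-lookup)
open import Data.List.Relation.Unary.All as All using (All; []; _∷_)
open import Data.List.Relation.Unary.All.Properties using (¬All⇒Any¬)
open import Data.List.Relation.Unary.AllPairs using (AllPairs; []; _∷_)
import Data.List.Relation.Unary.AllPairs.Properties as AllPairsₚ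
open import Data.List.Relation.Unary.Any using (Any; here; there; any?)
open import Data.List.Relation.Unary.Any.Properties using (++⁻)
open import Data.List.Relation.Unary.Unique.Propositional using (Unique)
import Data.List.Relation.Unary.Unique.Propositional.Properties as Uniqueₚ
open import Data.Nat as ℕ
  using (ℕ; zero; suc; _+_; _*_; _∸_; _⊔_; _^_; _≤_; _<_; z≤n; s≤s; NonZero; _≤?_; _<?_)
open import Data.Nat.DivMod using (_%_; m<n⇒m%n≡m; n%n≡0; m%n<n; m/n*n≤m; m≡m%n+[m/n]*n)
open import Data.Nat.Properties hiding (_≟_)
open import Data.Nat.ListAction.Properties using (sum-++)
open import Data.Nat.Tactic.RingSolver using (solve-∀)
open import Data.Product using (_×_; _,_; ∃-syntax; proj₁; proj₂)
open import Data.Sum using (_⊎_; inj₁; inj₂; [_,_]′)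
open import Data.Vec.Base using ([]; _∷_; here; there)
open import Function.Base using (_∘_; case_of_; id)
open import Level using (0ℓ)
open import Relation.Binary.Core using (Rel)
open import Relation.Binary.Definitions using (tri<; tri≈; tri>)
open import Relation.Binary.PropositionalEquality
open import Relation.Nullary using (¬_; yes; no; contradiction; Dec; _×-dec_; _→-dec_)
open import Relation.Nullary.Decidable using (¬?; decidable-stable)
open import Relation.Unary using (Pred; Decidable)

-- Cardinalities of finite sets

-- Which of `y`, `y′` closes the walk may change with `l`. This is harmless: the two walks differ
-- only in their first edge, so they have equal length, and the closing tree path has 2h edges in
-- either case. In a hypergraph the edges of the walk could also touch the closing path away from
-- its ends. That path lies in the older levels and in the two tree edges (the stems) joining its
-- ends to their parents. Arcs avoid the older levels altogether, so only the stems must be kept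
-- clear, and each vertex of a stem outside the older levels names its owner; excluding the owners
-- of all vertices met so far suffices when the next tail is chosen. No logarithm is ever evaluated.
-- With `d(G) / k = s / t` and `c` the number whose logarithm is `c₂`, the exploration yields the
-- integer inequality `s ^ j < n * (c * t) ^ j` for the level `j` where it stops, and the ceiling in
-- the theorem is, when the denominator is positive, the least `m` with `n * (c * t) ^ m ≤ s ^ m`.

∣∪∣+∣∩∣ : ∀ {n} (p q : Subset n) → ∣ p ∪ q ∣ + ∣ p ∩ q ∣ ≡ ∣ p ∣ + ∣ q ∣
∣∪∣+∣∩∣ [] [] = refl
∣∪∣+∣∩∣ (outside ∷ p) (outside ∷ q) = ∣∪∣+∣∩∣ p q
∣∪∣+∣∩∣ (outside ∷ p) (inside ∷ q) =
  trans (cong suc (∣∪∣+∣∩∣ p q)) (sym (+-suc ∣ p ∣ ∣ q ∣))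
∣∪∣+∣∩∣ (inside ∷ p) (outside ∷ q) = cong suc (∣∪∣+∣∩∣ p q)
∣∪∣+∣∩∣ (inside ∷ p) (inside ∷ q) = cong suc
  (trans (+-suc ∣ p ∪ q ∣ ∣ p ∩ q ∣)
  (trans (cong suc (∣∪∣+∣∩∣ p q)) (sym (+-suc ∣ p ∣ ∣ q ∣))))

module _ {n : ℕ} where

  empty⇒∣p∣≡0 : {p : Subset n} → (∀ {x} → x ∈ˢ p → ¬ x ∈ˢ p) → ∣ p ∣ ≡ 0
  empty⇒∣p∣≡0 {p} none with Subsetₚ.Empty-unique {p = p} (λ (_ , x∈p) → none x∈p x∈p)
  ... | refl = Subsetₚ.∣⊥∣≡0 n

  singleton⇒∣p∣≡1 : ∀ {p : Subset n} {x} → x ∈ˢ p → (∀ {y} → y ∈ˢ p → y ≡ x) → ∣ p ∣ ≡ 1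
  singleton⇒∣p∣≡1 {p} {x} x∈p only = trans (cong ∣_∣ p≡⁅x⁆) (∣⁅x⁆∣≡1 x)
    where
    p≡⁅x⁆ : p ≡ ⁅ x ⁆
    p≡⁅x⁆ = Subsetₚ.⊆-antisym
      (λ y∈p → subst (_∈ˢ ⁅ x ⁆) (sym (only y∈p)) (x∈⁅x⁆ x))
      (λ y∈ → subst (_∈ˢ p) (sym (x∈⁅y⁆⇒x≡y x y∈)) x∈p)

  pair⇒∣p∣≡2 : ∀ {p : Subset n} {x y} → x ≢ y → x ∈ˢ p → y ∈ˢ p →
               (∀ {z} → z ∈ˢ p → z ≡ x ⊎ z ≡ y) → ∣ p ∣ ≡ 2
  pair⇒∣p∣≡2 {p} {x} {y} x≢y x∈p y∈p only = trans (cong ∣_∣ p≡)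
    (+-cancelʳ-≡ 0 _ _ (trans (cong (∣ ⁅ x ⁆ ∪ ⁅ y ⁆ ∣ +_) (sym ∩≡0))
      (trans (∣∪∣+∣∩∣ ⁅ x ⁆ ⁅ y ⁆) (cong₂ _+_ (∣⁅x⁆∣≡1 x) (∣⁅x⁆∣≡1 y)))))
    where
    ∩≡0 : ∣ ⁅ x ⁆ ∩ ⁅ y ⁆ ∣ ≡ 0
    ∩≡0 = empty⇒∣p∣≡0 λ z∈ _ → let z∈x , z∈y = x∈p∩q⁻ ⁅ x ⁆ ⁅ y ⁆ z∈ in
      x≢y (trans (sym (x∈⁅y⁆⇒x≡y x z∈x)) (x∈⁅y⁆⇒x≡y y z∈y))
    p≡ : p ≡ ⁅ x ⁆ ∪ ⁅ y ⁆
    p≡ = Subsetₚ.⊆-antisym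
      (λ z∈p → x∈p∪q⁺ (case only z∈p of λ where
        (inj₁ refl) → inj₁ (x∈⁅x⁆ x)
        (inj₂ refl) → inj₂ (x∈⁅x⁆ y)))
      (λ z∈ → case x∈p∪q⁻ ⁅ x ⁆ ⁅ y ⁆ z∈ of λ where
        (inj₁ z∈x) → subst (_∈ˢ p) (sym (x∈⁅y⁆⇒x≡y x z∈x)) x∈p
        (inj₂ z∈y) → subst (_∈ˢ p) (sym (x∈⁅y⁆⇒x≡y y z∈y)) y∈p)

-- Linear paths and cycles

infix 4 _∈ᵛ_
_∈ᵛ_ : ∀ {n} → Fin n → List (Subset n) → Set
x ∈ᵛ es = Any (x ∈ˢ_) es

∈ᵛ⇒∈⋃ : ∀ {n} {x : Fin n} es → x ∈ᵛ es → x ∈ˢ ⋃ es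
∈ᵛ⇒∈⋃ (e ∷ es) (here x∈e)   = x∈p∪q⁺ (inj₁ x∈e)
∈ᵛ⇒∈⋃ (e ∷ es) (there x∈es) = x∈p∪q⁺ (inj₂ (∈ᵛ⇒∈⋃ es x∈es))

∈⋃⇒∈ᵛ : ∀ {n} {x : Fin n} es → x ∈ˢ ⋃ es → x ∈ᵛ es
∈⋃⇒∈ᵛ [] x∈ = contradiction x∈ Subsetₚ.∉⊥
∈⋃⇒∈ᵛ (e ∷ es) x∈ with x∈p∪q⁻ e (⋃ es) x∈
... | inj₁ x∈e  = here x∈e
... | inj₂ x∈es = there (∈⋃⇒∈ᵛ es x∈es)

lookup-∈ᵛ : ∀ {n} {x : Fin n} es i → x ∈ˢ lookup es i → x ∈ᵛ es
lookup-∈ᵛ (e ∷ es) zero    x∈ = here x∈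
lookup-∈ᵛ (e ∷ es) (suc i) x∈ = there (lookup-∈ᵛ es i x∈)

module _ {r n : ℕ} (G : RGraph r n) where

  -- One condition per edge encodes linearity: the next edge contains `v`, so it meets `e` exactly
  -- there, and by `start-once` no later edge contains `v`, so the later ones are disjoint from `e`.
  data Path : Fin n → List (Subset n) → Fin n → Set where
    nil  : ∀ {v} → Path v [] v
    cons : ∀ {e u v w es} → e ∈ edges G → u ∈ˢ e → v ∈ˢ e → u ≢ v →
           (∀ {x} → x ∈ˢ e → x ∈ᵛ es → x ≡ v) → Path v es w → Path u (e ∷ es) w

  -- The cycle is cut open at `e`, so that it can be obtained from a single gluing of paths.
  record Cycle (ℓ : ℕ) : Set where
    constructor mkCycle
    field
      {e}     : Subset n
      {es}    : List (Subset n)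
      {u v}   : Fin n
      e∈      : e ∈ edges G
      u∈e     : u ∈ˢ e
      v∈e     : v ∈ˢ e
      u≢v     : u ≢ v
      meet    : ∀ {x} → x ∈ˢ e → x ∈ᵛ es → x ≡ u ⊎ x ≡ v
      path    : Path v es u
      length≡ : suc (length es) ≡ ℓ

module _ {r n : ℕ} {G : RGraph r n} where

  edge⇒0<r : ∀ {e x} → e ∈ edges G → x ∈ˢ e → 0 < r
  edge⇒0<r e∈ x∈e = subst (0 <_) (All.lookup (uniform G) e∈)
    (≤-trans (s≤s z≤n) (Subsetₚ.x∈p⇒∣p-x∣<∣p∣ x∈e))

  path-edges : ∀ {u es w} → Path G u es w → ∀ i → lookup es i ∈ edges G
  path-edges (cons e∈ _ _ _ _ p) zero    = e∈
  path-edges (cons _ _ _ _ _ p)  (suc i) = path-edges p i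

  start∈ : ∀ {u e es w} → Path G u (e ∷ es) w → u ∈ˢ e
  start∈ (cons _ u∈e _ _ _ _) = u∈e

  end∈ : ∀ {u e es w} → Path G u (e ∷ es) w → w ∈ᵛ (e ∷ es)
  end∈ (cons _ _ v∈e _ _ nil)               = here v∈e
  end∈ (cons _ _ _   _ _ p@(cons _ _ _ _ _ _)) = there (end∈ p)

  start-once : ∀ {u es w} → Path G u es w → ∀ i → u ∈ˢ lookup es i → toℕ i ≡ 0
  start-once (cons _ _ _ _ _ _) zero _ = refl
  start-once (cons _ u∈e _ u≢v meet p) (suc i) u∈ =
    contradiction (meet u∈e (lookup-∈ᵛ _ i u∈)) u≢v

  start≢end : ∀ {u e es w} → Path G u (e ∷ es) w → u ≢ w
  start≢end (cons _ _ _ u≢v _ nil) refl = u≢v refl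
  start≢end (cons _ u∈e _ u≢v meet p@(cons _ _ _ _ _ _)) refl = u≢v (meet u∈e (end∈ p))

  end-last : ∀ {u es w} → Path G u es w → ∀ i → w ∈ˢ lookup es i → suc (toℕ i) ≡ length es
  end-last (cons _ _ _ _ _ nil) zero _ = refl
  end-last (cons _ _ _ _ meet p@(cons _ _ _ _ _ _)) zero w∈e =
    contradiction (sym (meet w∈e (end∈ p))) (start≢end p)
  end-last (cons _ _ _ _ _ p) (suc i) w∈ = cong suc (end-last p i w∈)

  meet-end : ∀ {u es w} {e : Subset n} → Path G u es w →
             (∀ {x} → x ∈ˢ e → x ∈ᵛ es → x ≡ u) → w ∈ˢ e → w ≡ u
  meet-end nil                  _    _   = refl
  meet-end p@(cons _ _ _ _ _ _) meet w∈e = meet w∈e (end∈ p)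

  path-++ : ∀ {u v w es fs} → Path G u es v → Path G v fs w →
            (∀ {x} → x ∈ᵛ es → x ∈ᵛ fs → x ≡ v) → Path G u (es ++ fs) w
  path-++ nil q _ = q
  path-++ {v = v} {fs = fs} (cons {e = e} {v = t} {es = es} e∈ u∈e t∈e u≢t meet p) q disj =
    cons e∈ u∈e t∈e u≢t meet′ (path-++ p q (disj ∘ there))
    where
    meet′ : ∀ {x} → x ∈ˢ e → x ∈ᵛ es ++ fs → x ≡ t
    meet′ x∈e x∈ with ++⁻ es x∈
    ... | inj₁ x∈es = meet x∈e x∈es
    -- A vertex of `e` on the second path is the gluing vertex, which is the end of `p`, and
    -- `meet-end` identifies it with `t`.
    ... | inj₂ x∈fs with disj (here x∈e) x∈fs
    ...   | refl = meet-end p meet x∈e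

  consecutive-meet : ∀ {u es w} → Path G u es w → ∀ i j → toℕ j ≡ suc (toℕ i) →
    ∣ lookup es i ∩ lookup es j ∣ ≡ 1
  consecutive-meet (cons {e = e} _ _ v∈e _ meet p@(cons {e = f} _ _ _ _ _ _)) zero (suc zero) _ =
    singleton⇒∣p∣≡1 (x∈p∩q⁺ (v∈e , start∈ p))
      λ x∈ → let x∈e , x∈f = x∈p∩q⁻ e f x∈ in meet x∈e (here x∈f)
  consecutive-meet (cons _ _ _ _ _ p) (suc i) (suc j) eq = consecutive-meet p i j (suc-injective eq)

  distant-disjoint : ∀ {u es w} → Path G u es w → ∀ i j → suc (toℕ i) < toℕ j →
    ∀ {x} → x ∈ˢ lookup es i → ¬ x ∈ˢ lookup es j
  distant-disjoint (cons _ _ _ _ meet p@(cons _ _ _ _ _ _)) zero (suc (suc j)) _ x∈e x∈f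
    with meet x∈e (there (lookup-∈ᵛ _ j x∈f))
  ... | refl = contradiction (start-once p (suc j) x∈f) λ ()
  distant-disjoint (cons _ _ _ _ _ (cons _ _ _ _ _ _)) zero (suc zero) (s≤s ())
  distant-disjoint (cons _ _ _ _ _ p) (suc i) (suc j) (s≤s lt) = distant-disjoint p i j lt

  -- Inclusion-exclusion: prepending an edge adds `r` vertices, exactly one of which is already
  -- present.
  ∣⋃path∣ : ∀ {u e es w} → Path G u (e ∷ es) w →
            ∣ ⋃ (e ∷ es) ∣ ≡ suc (length (e ∷ es) * (r ∸ 1))
  ∣⋃path∣ {e = e} (cons e∈ u∈e _ _ _ nil) = begin
    ∣ e ∪ Subset.⊥ ∣        ≡⟨ cong ∣_∣ (Subsetₚ.∪-identityʳ e) ⟩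
    ∣ e ∣                   ≡⟨ All.lookup (uniform G) e∈ ⟩
    r                       ≡⟨ m+[n∸m]≡n (edge⇒0<r e∈ u∈e) ⟨
    suc (r ∸ 1)             ≡⟨ cong suc (+-identityʳ (r ∸ 1)) ⟨
    suc (1 * (r ∸ 1))       ∎
    where
    open ≡-Reasoning
  ∣⋃path∣ {e = e} {es} (cons {v = v} e∈ u∈e v∈e _ meet p@(cons _ _ _ _ _ _)) =
    +-cancelʳ-≡ 1 _ _ (begin
      ∣ e ∪ ⋃ es ∣ + 1                        ≡⟨ cong (∣ e ∪ ⋃ es ∣ +_) ∩≡1 ⟨
      ∣ e ∪ ⋃ es ∣ + ∣ e ∩ ⋃ es ∣             ≡⟨ ∣∪∣+∣∩∣ e (⋃ es) ⟩
      ∣ e ∣ + ∣ ⋃ es ∣                        ≡⟨ cong₂ _+_ (All.lookup (uniform G) e∈) (∣⋃path∣ p) ⟩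
      r + suc (length es * (r ∸ 1))           ≡⟨ cong (_+ suc (length es * (r ∸ 1))) (m+[n∸m]≡n (edge⇒0<r e∈ u∈e)) ⟨
      suc (r ∸ 1) + suc (length es * (r ∸ 1)) ≡⟨ arith (r ∸ 1) (length es * (r ∸ 1)) ⟩
      suc (suc (length es) * (r ∸ 1)) + 1     ∎)
    where
    open ≡-Reasoning
    arith : ∀ a b → suc a + suc b ≡ suc (a + b) + 1
    arith = solve-∀
    ∩≡1 : ∣ e ∩ ⋃ es ∣ ≡ 1
    ∩≡1 = singleton⇒∣p∣≡1 (x∈p∩q⁺ (v∈e , ∈ᵛ⇒∈⋃ es (here (start∈ p))))
      λ x∈ → let x∈e , x∈es = x∈p∩q⁻ e (⋃ es) x∈ in meet x∈e (∈⋃⇒∈ᵛ es x∈es)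

next-cases : ∀ {ℓ} (i j : Fin ℓ) → Next i j →
  toℕ j ≡ suc (toℕ i) ⊎ (suc (toℕ i) ≡ ℓ × toℕ j ≡ 0)
next-cases {suc ℓ} i j next with m≤n⇒m<n∨m≡n (toℕ<n i)
... | inj₁ lt = inj₁ (trans (sym next) (m<n⇒m%n≡m lt))
... | inj₂ eq = inj₂ (eq , trans (sym next) (trans (cong (_% suc ℓ) eq) (n%n≡0 (suc ℓ))))

next-suc : ∀ {ℓ} (i j : Fin ℓ) → toℕ j ≡ suc (toℕ i) → Next i j
next-suc {suc ℓ} i j eq = trans (m<n⇒m%n≡m (subst (_< suc ℓ) eq (toℕ<n j))) (sym eq)

next-wrap : ∀ {ℓ} (i j : Fin ℓ) → suc (toℕ i) ≡ ℓ → toℕ j ≡ 0 → Next i j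
next-wrap {suc ℓ} i j eq eq₀ = trans (cong (_% suc ℓ) eq) (trans (n%n≡0 (suc ℓ)) (sym eq₀))

module _ {r n : ℕ} {G : RGraph r n} where

  -- The closing edge shares exactly `u` and `v` with the union of the path, which turns the count
  -- `∣⋃path∣` into `(r ∸ 1) * ℓ`. With only one further edge the two edges would share both
  -- vertices, hence `3 ≤ ℓ`.
  cycle⇒linearCycle : ∀ {ℓ} → 3 ≤ ℓ → Cycle G ℓ → LinearCycle G ℓ
  cycle⇒linearCycle 3≤ℓ (mkCycle {es = []} _ _ _ _ _ _ refl) = contradiction 3≤ℓ λ { (s≤s ()) }
  cycle⇒linearCycle 3≤ℓ (mkCycle {es = _ ∷ []} _ _ _ _ _ _ refl) =
    contradiction 3≤ℓ λ { (s≤s (s≤s ())) }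
  cycle⇒linearCycle 3≤ℓ (mkCycle {e} {es@(f ∷ g ∷ hs)} {u} {v} e∈ u∈e v∈e u≢v meet p refl) = record
    { 3≤ℓ         = 3≤ℓ
    ; edge        = lookup (e ∷ es)
    ; edge∈       = λ { zero → e∈ ; (suc i) → path-edges p i }
    ; vertexCount = trans (cong (∣_∣ ∘ ⋃) (tabulate-lookup (e ∷ es))) count
    ; consecutive = λ {i} {j} → λ where
        (inj₁ next) → forward i j next
        (inj₂ next) → trans (cong ∣_∣ (∩-comm (E i) (E j))) (forward j i next)
    ; disjoint    = λ {i} {j} i≢j ¬next → case <-cmp (toℕ i) (toℕ j) of λ where
        (tri< i<j _ _) → empty⇒∣p∣≡0 λ x∈ _ →
          let x∈i , x∈j = x∈p∩q⁻ (E i) (E j) x∈ in apart i j i<j ¬next x∈i x∈j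
        (tri≈ _ i≡j _) → contradiction (toℕ-injective i≡j) i≢j
        (tri> _ _ j<i) → empty⇒∣p∣≡0 λ x∈ _ →
          let x∈i , x∈j = x∈p∩q⁻ (E i) (E j) x∈ in
          apart j i j<i (¬next ∘ [ inj₂ , inj₁ ]′) x∈j x∈i
    }
    where
    ℓ = length (e ∷ es)
    E = lookup (e ∷ es)

    count : ∣ ⋃ (e ∷ es) ∣ ≡ (r ∸ 1) * ℓ
    count = +-cancelʳ-≡ 2 _ _ (begin
      ∣ e ∪ ⋃ es ∣ + 2                        ≡⟨ cong (∣ e ∪ ⋃ es ∣ +_) ∩≡2 ⟨
      ∣ e ∪ ⋃ es ∣ + ∣ e ∩ ⋃ es ∣             ≡⟨ ∣∪∣+∣∩∣ e (⋃ es) ⟩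
      ∣ e ∣ + ∣ ⋃ es ∣                        ≡⟨ cong₂ _+_ (All.lookup (uniform G) e∈) (∣⋃path∣ p) ⟩
      r + suc (length es * (r ∸ 1))           ≡⟨ cong (_+ suc (length es * (r ∸ 1))) (m+[n∸m]≡n (edge⇒0<r {G = G} e∈ u∈e)) ⟨
      suc (r ∸ 1) + suc (length es * (r ∸ 1)) ≡⟨ arith (r ∸ 1) (length es) ⟩
      (r ∸ 1) * ℓ + 2                         ∎)
      where
      open ≡-Reasoning
      arith : ∀ a b → suc a + suc (b * a) ≡ a * suc b + 2
      arith = solve-∀
      ∩≡2 : ∣ e ∩ ⋃ es ∣ ≡ 2
      ∩≡2 = pair⇒∣p∣≡2 u≢v (x∈p∩q⁺ (u∈e , ∈ᵛ⇒∈⋃ es (end∈ p)))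
        (x∈p∩q⁺ (v∈e , ∈ᵛ⇒∈⋃ es (here (start∈ p))))
        λ x∈ → let x∈e , x∈es = x∈p∩q⁻ e (⋃ es) x∈ in meet x∈e (∈⋃⇒∈ᵛ es x∈es)

    end∈last : ∀ {u es w} → Path G u es w → ∀ i → suc (toℕ i) ≡ length es → w ∈ˢ lookup es i
    end∈last (cons _ _ v∈e _ _ nil) zero _ = v∈e
    end∈last (cons _ _ _ _ _ (cons _ _ _ _ _ _)) zero ()
    end∈last (cons _ _ _ _ _ p) (suc i) eq = end∈last p i (suc-injective eq)

    forward : ∀ i j → Next i j → ∣ E i ∩ E j ∣ ≡ 1
    forward i j next with next-cases i j next
    forward zero (suc zero) next | inj₁ _ =
      singleton⇒∣p∣≡1 (x∈p∩q⁺ (v∈e , start∈ p)) λ x∈ →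
        let x∈e , x∈f = x∈p∩q⁻ e f x∈ in case meet x∈e (here x∈f) of λ where
          -- `u` lies only in the last edge of the path, and `f` is followed by `g`.
          (inj₁ refl) → contradiction (end-last p zero x∈f) λ ()
          (inj₂ x≡v)  → x≡v
    forward (suc i) (suc j) next | inj₁ eq = consecutive-meet p i j (suc-injective eq)
    forward (suc i) zero next | inj₂ (eq , _) =
      singleton⇒∣p∣≡1 (x∈p∩q⁺ (end∈last p i (suc-injective eq) , u∈e)) λ x∈ →
        let x∈i , x∈e = x∈p∩q⁻ (lookup es i) e x∈ in
        case meet x∈e (lookup-∈ᵛ es i x∈i) of λ where
          (inj₁ x≡u)  → x≡u
          (inj₂ refl) → contradiction
            (trans (sym (suc-injective eq)) (cong suc (start-once p i x∈i))) λ ()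

    apart : ∀ i j → toℕ i < toℕ j → ¬ (Next i j ⊎ Next j i) →
            ∀ {x} → x ∈ˢ E i → ¬ x ∈ˢ E j
    apart zero (suc j) _ ¬next x∈e x∈j with meet x∈e (lookup-∈ᵛ es j x∈j)
    -- The two shared vertices of `e` lie in the last and in the first edge of the path, both of
    -- which are neighbours of `e` in the cyclic order.
    ... | inj₁ refl = ¬next (inj₂ (next-wrap (suc j) (zero {n = length es}) (cong suc (end-last p j x∈j)) refl))
    ... | inj₂ refl = ¬next (inj₁ (next-suc (zero {n = length es}) (suc j) (cong suc (start-once p j x∈j))))
    apart (suc i) (suc j) (s≤s lt) ¬next x∈i x∈j = distant-disjoint p i j
      (≤∧≢⇒< lt λ eq → ¬next (inj₁ (next-suc (suc i) (suc j) (cong suc (sym eq))))) x∈i x∈j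

-- Counting in lists

module _ {A : Set} where

  count : {P : Pred A 0ℓ} → Decidable P → List A → ℕ
  count P? xs = length (filter P? xs)

  count-cover : {P Q R : Pred A 0ℓ} (P? : Decidable P) (Q? : Decidable Q) (R? : Decidable R) → ∀ xs →
    (∀ {x} → x ∈ xs → P x → Q x ⊎ R x) → count P? xs ≤ count Q? xs + count R? xs
  count-cover P? Q? R? [] _ = z≤n
  count-cover P? Q? R? (x ∷ xs) f with ih ← count-cover P? Q? R? xs (f ∘ there) | P? x | Q? x | R? x
  ... | yes p | yes q | yes _ = s≤s (≤-trans ih (+-monoʳ-≤ _ (n≤1+n _)))
  ... | yes p | yes q | no _  = s≤s ih
  ... | yes p | no _  | yes _ = ≤-trans (s≤s ih) (≤-reflexive (sym (+-suc (count Q? xs) (count R? xs))))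
  ... | yes p | no ¬q | no ¬r = contradiction (f (here refl) p) [ ¬q , ¬r ]′
  ... | no _  | yes q | yes _ = m≤n⇒m≤1+n (≤-trans ih (+-monoʳ-≤ _ (n≤1+n _)))
  ... | no _  | yes q | no _  = m≤n⇒m≤1+n ih
  ... | no _  | no _  | yes _ = ≤-trans ih (+-monoʳ-≤ _ (n≤1+n _))
  ... | no _  | no _  | no _  = ih

  length≡count+count¬ : {P : Pred A 0ℓ} (P? : Decidable P) → ∀ xs →
    length xs ≡ count P? xs + count (¬? ∘ P?) xs
  length≡count+count¬ P? [] = refl
  length≡count+count¬ P? (x ∷ xs) with ih ← length≡count+count¬ P? xs | P? x
  ... | yes _ = cong suc ih
  ... | no _  = trans (cong suc ih) (sym (+-suc _ _))

  count≤1 : {P : Pred A 0ℓ} (P? : Decidable P) {S : Rel A 0ℓ} {xs : List A} → AllPairs S xs →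
    (∀ {x y} → x ∈ xs → y ∈ xs → P x → P y → ¬ S x y) → count P? xs ≤ 1
  count≤1 P? [] _ = z≤n
  count≤1 P? {xs = x ∷ xs} (Sx ∷ Sxs) f with P? x
  ... | no _  = count≤1 P? Sxs λ x∈ y∈ → f (there x∈) (there y∈)
  ... | yes p = s≤s (≤-reflexive (cong length (filter-none P? {xs = xs}
    (All.tabulate λ y∈ q → f (here refl) (there y∈) p q (All.lookup Sx y∈)))))

  -- Repeatedly discarding the items incident to a label of small nonzero degree
  -- costs at most d items per label.
  prune : {K : Set} {R : K → Pred A 0ℓ} (R? : ∀ k → Decidable (R k)) {S : Rel A 0ℓ} (d : ℕ)
    (ks : List K) (xs : List A) → length ks * d < length xs → AllPairs S xs →
    ∃[ ys ] 0 < length ys × (∀ {y} → y ∈ ys → y ∈ xs) × AllPairs S ys ×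
            (∀ {k y} → k ∈ ks → y ∈ ys → R k y → d < count (R? k) ys)
  prune {K} {R} R? {S} d ks xs = go (length ks) ks xs refl
    where
    Low : List A → K → Set
    Low xs k = 0 < count (R? k) xs × count (R? k) xs ≤ d
    low? : ∀ xs → Decidable (Low xs)
    low? xs k = (0 <? count (R? k) xs) ×-dec (count (R? k) xs ≤? d)
    go : ∀ m (ks : List K) (xs : List A) → length ks ≡ m → length ks * d < length xs → AllPairs S xs →
      ∃[ ys ] 0 < length ys × (∀ {y} → y ∈ ys → y ∈ xs) × AllPairs S ys ×
              (∀ {k y} → k ∈ ks → y ∈ ys → R k y → d < count (R? k) ys)
    go m ks xs eq lt Sxs with any? (low? xs) ks
    ... | no ¬low = xs , ≤-<-trans z≤n lt , id , Sxs , λ k∈ y∈ Rky →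
      ≰⇒> λ le → ¬low (lose k∈ (filter-some (R? _) (lose y∈ Rky) , le))
    ... | yes low with find low
    go zero [] xs eq lt Sxs | yes low | k , () , _
    go (suc m) ks xs eq lt Sxs | yes low | k , k∈ , _ , small with ∈-∃++ k∈
    ... | as , bs , refl =
      let ys , 0< , ys⊆ , Sys , min = go m (as ++ bs) xs′ (suc-injective (trans (sym len) eq)) lt′ (AllPairsₚ.filter⁺ _ Sxs)
      in ys , 0< , proj₁ ∘ ∈-filter⁻ (¬? ∘ R? k) ∘ ys⊆ , Sys , λ k′∈ y∈ Rk′y → case ∈-++⁻ as k′∈ of λ where
        (inj₁ k′∈as)         → min (∈-++⁺ˡ k′∈as) y∈ Rk′y
        (inj₂ (here refl))   → contradiction Rk′y (proj₂ (∈-filter⁻ (¬? ∘ R? k) {xs = xs} (ys⊆ y∈)))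
        (inj₂ (there k′∈bs)) → min (∈-++⁺ʳ as k′∈bs) y∈ Rk′y
      where
      xs′ = filter (¬? ∘ R? k) xs
      len : length (as ++ k ∷ bs) ≡ suc (length (as ++ bs))
      len = trans (length-++ as) (trans (+-suc _ _) (cong suc (sym (length-++ as))))
      -- Dropping one label pays for the at most `d` discarded items, so the strict inequality
      -- survives and in the end forces a nonempty list.
      lt′ : length (as ++ bs) * d < length xs′
      lt′ = +-cancelˡ-< d _ _ (begin-strict
        d + length (as ++ bs) * d              ≡⟨ cong (_* d) len ⟨
        length (as ++ k ∷ bs) * d              <⟨ lt ⟩
        length xs                              ≡⟨ length≡count+count¬ (R? k) xs ⟩
        count (R? k) xs + length xs′           ≤⟨ +-monoˡ-≤ _ small ⟩
        d + length xs′                         ∎)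
        where open ≤-Reasoning

-- Vertex lists and degrees

unique⇒length≤∣p∣ : ∀ {n} {xs : List (Fin n)} {p : Subset n} →
  Unique xs → (∀ {x} → x ∈ xs → x ∈ˢ p) → length xs ≤ ∣ p ∣
unique⇒length≤∣p∣ [] _ = z≤n
unique⇒length≤∣p∣ (x∉ ∷ xs!) f = ≤-trans
  (s≤s (unique⇒length≤∣p∣ xs! λ y∈ → Subsetₚ.x∈p∧x≢y⇒x∈p-y (f (there y∈)) (All.lookup x∉ y∈ ∘ sym)))
  (Subsetₚ.x∈p⇒∣p-x∣<∣p∣ (f (here refl)))

unique⇒length≤n : ∀ {n} {xs : List (Fin n)} → Unique xs → length xs ≤ n
unique⇒length≤n {n} xs! = ≤-trans (unique⇒length≤∣p∣ xs! λ _ → Subsetₚ.∈⊤) (≤-reflexive (Subsetₚ.∣⊤∣≡n n))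

module _ {n : ℕ} where

  vertices : Subset n → List (Fin n)
  vertices p = filter (_∈? p) (allFin n)

  ∈-vertices⁺ : ∀ {p x} → x ∈ˢ p → x ∈ vertices p
  ∈-vertices⁺ {p} {x} = ∈-filter⁺ (_∈? p) (∈-allFin x)

  ∈-vertices⁻ : ∀ {p x} → x ∈ vertices p → x ∈ˢ p
  ∈-vertices⁻ {p} x∈ = proj₂ (∈-filter⁻ (_∈? p) {xs = allFin n} x∈)

  length-vertices : ∀ p → length (vertices p) ≤ ∣ p ∣
  length-vertices p = unique⇒length≤∣p∣ (Uniqueₚ.filter⁺ (_∈? p) (Uniqueₚ.allFin⁺ n)) ∈-vertices⁻

  degree : List (Subset n) → Fin n → ℕ
  degree E x = count (x ∈?_) E

  Δ : List (Subset n) → List (Fin n) → ℕ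
  Δ E xs = sum (map (degree E) xs)

  Meets : List (Fin n) → Subset n → Set
  Meets xs e = Any (_∈ˢ e) xs

  meets? : ∀ xs → Decidable (Meets xs)
  meets? xs e = any? (_∈? e) xs

  count-meets≤Δ : ∀ E xs → count (meets? xs) E ≤ Δ E xs
  count-meets≤Δ E [] = ≤-reflexive (cong length (filter-none (meets? []) {xs = E} (All.tabulate λ _ ())))
  count-meets≤Δ E (x ∷ xs) = ≤-trans
    (count-cover (meets? (x ∷ xs)) (x ∈?_) (meets? xs) E λ where
      _ (here x∈e)   → inj₁ x∈e
      _ (there xs∈e) → inj₂ xs∈e)
    (+-monoʳ-≤ _ (count-meets≤Δ E xs))

  -- Double counting of incidences: an edge is counted at most `r` times, once for each of its
  -- vertices.
  Δ≤count-meets : ∀ {r E xs} → Unique xs → All (λ e → ∣ e ∣ ≡ r) E →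
                  Δ E xs ≤ r * count (meets? xs) E
  Δ≤count-meets {r} {[]} {xs} xs! [] = ≤-trans (≤-reflexive (none xs)) z≤n
    where
    none : ∀ xs → Δ [] xs ≡ 0
    none [] = refl
    none (_ ∷ xs) = none xs
  Δ≤count-meets {r} {e ∷ E} {xs} xs! (eq ∷ eqs) = begin
    Δ (e ∷ E) xs                                ≡⟨ split xs ⟩
    count (_∈? e) xs + Δ E xs                   ≤⟨ +-monoʳ-≤ (count (_∈? e) xs) (Δ≤count-meets xs! eqs) ⟩
    count (_∈? e) xs + r * count (meets? xs) E  ≤⟨ step ⟩
    r * count (meets? xs) (e ∷ E)               ∎
    where
    open ≤-Reasoning
    comm : ∀ a b c → a + (b + c) ≡ b + (a + c)
    comm = solve-∀
    split : ∀ xs → Δ (e ∷ E) xs ≡ count (_∈? e) xs + Δ E xs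
    split [] = refl
    split (x ∷ xs) with ih ← split xs | x ∈? e
    ... | yes _ = cong suc (trans (cong (degree E x +_) ih) (comm (degree E x) (count (_∈? e) xs) (Δ E xs)))
    ... | no _  = trans (cong (degree E x +_) ih) (comm (degree E x) (count (_∈? e) xs) (Δ E xs))
    step : count (_∈? e) xs + r * count (meets? xs) E ≤ r * count (meets? xs) (e ∷ E)
    step with meets? xs e
    ... | yes _ = ≤-trans (+-monoˡ-≤ _ (≤-trans
      (unique⇒length≤∣p∣ (Uniqueₚ.filter⁺ (_∈? e) xs!) (proj₂ ∘ ∈-filter⁻ (_∈? e) {xs = xs}))
      (≤-reflexive eq))) (≤-reflexive (sym (*-suc r (count (meets? xs) E))))
    ... | no ¬m = +-monoˡ-≤ _ (≤-trans (≤-reflexive (cong length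
      (filter-none (_∈? e) {xs = xs} (All.tabulate λ x∈ x∈e → ¬m (lose x∈ x∈e))))) z≤n)

  -- In a linear hypergraph each vertex y ≢ c lies in at most one edge through c.
  avoid : {A : Set} (edge : A → Subset n) (c : Fin n) (as : List A) →
    AllPairs (λ a b → edge a ≢ edge b) as →
    (∀ {a} → a ∈ as → c ∈ˢ edge a) →
    (∀ {a b x} → a ∈ as → b ∈ as → edge a ≢ edge b → x ∈ˢ edge a → x ∈ˢ edge b → x ≡ c) →
    ∀ Y → length Y < length as → ∃[ a ] a ∈ as × (∀ {y} → y ∈ Y → y ∈ˢ edge a → y ≡ c)
  avoid edge c (a ∷ as) _ _ _ [] _ = a , here refl , λ ()
  avoid edge c as distinct c∈ linear (y ∷ Y) lt with y ≟ c
  ... | yes refl = let a , a∈ , ok = avoid edge c as distinct c∈ linear Y (<-trans (n<1+n _) lt) in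
    a , a∈ , λ { (here refl) _ → refl ; (there y∈) → ok y∈ }
  ... | no y≢c = let a , a∈ , ok = avoid edge c as′ (AllPairsₚ.filter⁺ _ distinct) (c∈ ∘ as′⊆as)
                       (λ a∈ b∈ → linear (as′⊆as a∈) (as′⊆as b∈)) Y lt′ in
    a , as′⊆as a∈ , λ where
      (here refl) y∈a → contradiction y∈a (proj₂ (∈-filter⁻ Q? {xs = as} a∈))
      (there y∈)      → ok y∈
    where
    P? = λ a → y ∈? edge a
    Q? = ¬? ∘ P?
    as′ = filter Q? as
    as′⊆as : ∀ {a} → a ∈ as′ → a ∈ as
    as′⊆as = proj₁ ∘ ∈-filter⁻ Q?
    lt′ : length Y < length as′
    lt′ = +-cancelˡ-< 1 _ _ (<-≤-trans lt (≤-trans (≤-reflexive (length≡count+count¬ P? as))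
      (+-monoˡ-≤ _ (count≤1 P? distinct λ a∈ b∈ y∈a y∈b a≢b → y≢c (linear a∈ b∈ a≢b y∈a y∈b)))))

  twoCommon⇒≡ : ∀ {r} {G : RGraph r n} → Linear G → ∀ {e f x y} → e ∈ edges G → f ∈ edges G →
    e ≢ f → x ∈ˢ e → x ∈ˢ f → y ∈ˢ e → y ∈ˢ f → x ≡ y
  twoCommon⇒≡ lin {e} {f} {x} {y} e∈ f∈ e≢f x∈e x∈f y∈e y∈f with x ≟ y
  ... | yes x≡y = x≡y
  ... | no x≢y = contradiction (≤-trans
    (unique⇒length≤∣p∣ {xs = x ∷ y ∷ []} ((x≢y ∷ []) ∷ [] ∷ []) λ where
      (here refl)         → Subsetₚ.x∈p∩q⁺ (x∈e , x∈f)
      (there (here refl)) → Subsetₚ.x∈p∩q⁺ (y∈e , y∈f))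
    (lin e∈ f∈ e≢f)) λ { (s≤s ()) }

-- Hypertrees and dense levels

module _ {r n : ℕ} (G : RGraph r n) where

  -- The tree up to level i.  Only the vertices in top have descendants; η is
  -- the height of the least common ancestor, and stem y is the tree edge
  -- joining y to its parent.
  record Tree (i : ℕ) : Set where
    field
      top new old : List (Fin n)
      stem        : Fin n → Subset n
      owner       : Fin n → Fin n
      η           : Fin n → Fin n → ℕ
      top!        : Unique top
      top⊆new     : ∀ {x} → x ∈ top → x ∈ new
      stem-meet   : ∀ {x y e} → y ∈ top → e ∈ edges G → ¬ Meets old e → y ∈ˢ e →
                    x ∈ˢ e → x ∈ˢ stem y → x ≡ y
      ∣stem∣≤r    : ∀ {y} → y ∈ top → ∣ stem y ∣ ≤ r
      stem⊆       : ∀ {x y} → y ∈ top → x ∈ˢ stem y → x ∈ old ⊎ x ∈ new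
      -- A top vertex is recovered from any vertex of its stem outside `old`, so a set of vertices
      -- disjoint from `old` touches the stems of at most as many tops as it has elements.
      owner-stem  : ∀ {x y} → y ∈ top → x ∈ˢ stem y → ¬ x ∈ old → owner x ≡ y
      η-refl      : ∀ x → η x x ≡ 0
      η-sym       : ∀ x y → η x y ≡ η y x
      η-ultra     : ∀ x y z → η x z ≤ η x y ⊔ η y z
      η≤i         : ∀ x y → η x y ≤ i
      η-pos       : ∀ {x y} → x ∈ top → y ∈ top → x ≢ y → 0 < η x y
      link        : ∀ {x y} → x ∈ top → y ∈ top → x ≢ y →
                    ∃[ es ] Path G x es y × length es ≡ 2 * η x y ×
                    (∀ {z} → z ∈ᵛ es → z ∈ old ⊎ z ∈ˢ stem x ⊎ z ∈ˢ stem y)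

-- Walks along arcs and their closure to cycles

record Arc (n : ℕ) : Set where
  constructor arc
  field
    edge      : Subset n
    tail head : Fin n

module _ {r n : ℕ} {G : RGraph r n} (linear : Linear G) {i : ℕ} (lv : Tree G i) where

  open Tree lv
  open Arc

  record IsArc (a : Arc n) : Set where
    field
      edge∈     : edge a ∈ edges G
      clear     : ¬ Meets old (edge a)
      tail∈top  : tail a ∈ top
      tail∈     : tail a ∈ˢ edge a
      head∈     : head a ∈ˢ edge a
      tail≢head : tail a ≢ head a

  -- A path from c to w that can be closed up with a tree path from w.
  record Strand (Xs : List (Fin n)) (w : Fin n) (R : List (Subset n)) (c : Fin n) : Set where
    field
      path      : Path G c R w
      start     : c ∈ᵛ R
      clear     : ∀ {x} → x ∈ᵛ R → ¬ x ∈ old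
      seen      : ∀ {x} → x ∈ᵛ R → x ∈ Xs
      end-seen  : w ∈ Xs
      stem-seen : ∀ {x} → x ∈ˢ stem w → x ∈ Xs
      own       : ∀ {x} → x ∈ᵛ R → x ∈ˢ stem w → x ≡ w

  -- The path is stored from its moving end back to `w`, so a walk grows by `cons`. Meeting `Xs`
  -- only at `c` is enough, since `Xs` contains every vertex of the path and of the stem of `w`.
  extend : ∀ {Xs w R c c′} {e : Subset n} → Strand Xs w R c → e ∈ edges G → ¬ Meets old e →
    c ∈ˢ e → c′ ∈ˢ e → c′ ≢ c → (∀ {x} → x ∈ Xs → x ∈ˢ e → x ≡ c) →
    Strand (Xs ++ vertices e) w (e ∷ R) c′
  extend {Xs} s e∈ clear-e c∈e c′∈e c′≢c fit = record
    { path      = cons e∈ c′∈e c∈e c′≢c (λ x∈e x∈R → fit (seen x∈R) x∈e) path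
    ; start     = here c′∈e
    ; clear     = λ { (here x∈e) x∈old → clear-e (lose x∈old x∈e) ; (there x∈R) → clear x∈R }
    ; seen      = λ { (here x∈e) → ∈-++⁺ʳ Xs (∈-vertices⁺ x∈e) ; (there x∈R) → ∈-++⁺ˡ (seen x∈R) }
    ; end-seen  = ∈-++⁺ˡ end-seen
    ; stem-seen = ∈-++⁺ˡ ∘ stem-seen
    ; own       = λ where
        (here x∈e) x∈stem → case fit (stem-seen x∈stem) x∈e of λ where
          refl → own start x∈stem
        (there x∈R) → own x∈R
    }
    where open Strand s

  -- The tree path from `w` to `z` lies in `old` and the stems of `w` and `z`; the strand avoids
  -- `old` and meets these stems only at `w` and `z`. The first edge of the strand is the one where
  -- the cycle is cut open.
  close : ∀ {Xs w R z} → Strand Xs w R z → w ∈ top → z ∈ top → w ≢ z →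
    (∀ {x} → x ∈ᵛ R → x ∈ˢ stem z → x ≡ z) → Cycle G (length R + 2 * η w z)
  close {w = w} {z = z} s w∈ z∈ w≢z own-z = go (Strand.path s) (Strand.clear s) (Strand.own s) own-z
    where
    go : ∀ {R} → Path G z R w → (∀ {x} → x ∈ᵛ R → ¬ x ∈ old) → (∀ {x} → x ∈ᵛ R → x ∈ˢ stem w → x ≡ w) →
         (∀ {x} → x ∈ᵛ R → x ∈ˢ stem z → x ≡ z) → Cycle G (length R + 2 * η w z)
    go nil _ _ _ = contradiction refl w≢z
    go (cons {e = e} {v = v} {es = R} e∈ z∈e v∈e z≢v meet p) clear own own-z with link w∈ z∈ w≢z
    ... | T , q , len , T⊆ = mkCycle e∈ z∈e v∈e z≢v meet′ (path-++ p q disj)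
            (cong suc (trans (length-++ R) (cong (length R +_) len)))
      where
      disj : ∀ {x} → x ∈ᵛ R → x ∈ᵛ T → x ≡ w
      disj x∈R x∈T with T⊆ x∈T
      ... | inj₁ x∈old         = contradiction x∈old (clear (there x∈R))
      ... | inj₂ (inj₁ x∈stem) = own (there x∈R) x∈stem
      ... | inj₂ (inj₂ x∈stem) with own-z (there x∈R) x∈stem
      ...   | refl = contradiction (meet z∈e x∈R) z≢v
      meet′ : ∀ {x} → x ∈ˢ e → x ∈ᵛ R ++ T → x ≡ z ⊎ x ≡ v
      meet′ x∈e x∈ with ++⁻ R x∈
      ... | inj₁ x∈R = inj₂ (meet x∈e x∈R)
      ... | inj₂ x∈T with T⊆ x∈T
      ...   | inj₁ x∈old         = contradiction x∈old (clear (here x∈e))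
      ...   | inj₂ (inj₂ x∈stem) = inj₁ (own-z (here x∈e) x∈stem)
      ...   | inj₂ (inj₁ x∈stem) with own (here x∈e) x∈stem
      ...     | refl = inj₂ (meet-end p meet x∈e)

  module Dense (k d : ℕ) (arcs : List (Arc n))
    (distinct : AllPairs (λ a b → edge a ≢ edge b) arcs)
    (isArc : ∀ {a} → a ∈ arcs → IsArc a)
    (tail-degree : ∀ {a} → a ∈ arcs → d < count (λ b → tail b ≟ tail a) arcs)
    (head-degree : ∀ {a} → a ∈ arcs → d < count (λ b → head b ≟ head a) arcs)
    (d-large : 4 * (suc k * r) ≤ d)
    where

    module A {a} (a∈ : a ∈ arcs) = IsArc (isArc a∈)

    -- More than `d` arcs with distinct edges pass through `c`, and by linearity a forbidden vertex
    -- other than `c` lies on at most one of them.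
    pick : {P : Pred (Arc n) 0ℓ} (P? : Decidable P) (c : Fin n) → d < count P? arcs →
      (∀ {b} → b ∈ arcs → P b → c ∈ˢ edge b) → ∀ Y → length Y ≤ d →
      ∃[ b ] b ∈ arcs × P b × (∀ {y} → y ∈ Y → y ∈ˢ edge b → y ≡ c)
    pick P? c d< c∈ Y ≤d =
      let b , b∈ , fit = avoid edge c (filter P? arcs) (AllPairsₚ.filter⁺ P? distinct)
            (λ b∈ → let b∈arcs , Pb = ∈-filter⁻ P? b∈ in c∈ b∈arcs Pb)
            (λ a∈ b∈ a≢b x∈a x∈b →
              let a∈arcs , Pa = ∈-filter⁻ P? a∈
                  b∈arcs , Pb = ∈-filter⁻ P? b∈
              in twoCommon⇒≡ {G = G} linear (A.edge∈ a∈arcs) (A.edge∈ b∈arcs) a≢b x∈a x∈b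
                   (c∈ a∈arcs Pa) (c∈ b∈arcs Pb))
            Y (≤-<-trans ≤d d<)
          b∈arcs , Pb = ∈-filter⁻ P? b∈
      in b , b∈arcs , Pb , fit

    pickTail : ∀ {a} → a ∈ arcs → ∀ Y → length Y ≤ d →
      ∃[ b ] b ∈ arcs × tail b ≡ tail a × (∀ {y} → y ∈ Y → y ∈ˢ edge b → y ≡ tail a)
    pickTail {a} a∈ = pick (λ b → tail b ≟ tail a) (tail a) (tail-degree a∈)
      λ {b} b∈ eq → subst (_∈ˢ edge b) eq (A.tail∈ b∈)

    pickHead : ∀ {a} → a ∈ arcs → ∀ Y → length Y ≤ d →
      ∃[ b ] b ∈ arcs × head b ≡ head a × (∀ {y} → y ∈ Y → y ∈ˢ edge b → y ≡ head a)
    pickHead {a} a∈ = pick (λ b → head b ≟ head a) (head a) (head-degree a∈)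
      λ {b} b∈ eq → subst (_∈ˢ edge b) eq (A.head∈ b∈)

    length-vertices-edge : ∀ {a} → a ∈ arcs → length (vertices (edge a)) ≤ r
    length-vertices-edge {a} a∈ = ≤-trans (length-vertices (edge a))
      (≤-reflexive (All.lookup (uniform G) (A.edge∈ a∈)))

    module Widest (a : Bool → Arc n) (a∈ : ∀ j → a j ∈ arcs)
      (same-head : head (a true) ≡ head (a false))
      (y≢ : tail (a true) ≢ tail (a false))
      (widest : ∀ {b c} → b ∈ arcs → c ∈ arcs → head b ≡ head c →
                η (tail b) (tail c) ≤ η (tail (a true)) (tail (a false)))
      where

      y : Bool → Fin n
      y j = tail (a j)

      h : ℕ
      h = η (y true) (y false)

      -- `b` is the last arc walked. Both strands share all edges but the first. The bound on `Xs`
      -- pays `r` for each of two stems, two first edges and `2 * m` later edges.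
      record AtHead (m : ℕ) : Set where
        field
          Xs      : List (Fin n)
          Xs-size : length Xs ≤ (4 + 2 * m) * r
          {b}     : Arc n
          b∈      : b ∈ arcs
          R       : Bool → List (Subset n)
          R-size  : ∀ j → length (R j) ≡ 1 + 2 * m
          strand  : ∀ j → Strand Xs (y j) (R j) (head b)
          near    : ∀ j → η (y j) (tail b) ≤ h

      record AtTail (m : ℕ) : Set where
        field
          Xs      : List (Fin n)
          Xs-size : length Xs ≤ (5 + 2 * m) * r
          {b}     : Arc n
          b∈      : b ∈ arcs
          R       : Bool → List (Subset n)
          R-size  : ∀ j → length (R j) ≡ 2 + 2 * m
          strand  : ∀ j → Strand Xs (y j) (R j) (tail b)
          near    : ∀ j → η (y j) (tail b) ≤ h
          fresh   : ∀ j → y j ≢ tail b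
          own     : ∀ j {x} → x ∈ᵛ R j → x ∈ˢ stem (tail b) → x ≡ tail b

      begin-walk : AtHead 0
      begin-walk = record
        { Xs      = Xs
        ; Xs-size = size
        ; b∈      = a∈ true
        ; R       = λ j → edge (a j) ∷ []
        ; R-size  = λ _ → refl
        ; strand  = λ j → record
            { path      = cons (A.edge∈ (a∈ j)) (b∈ᵉ j) (A.tail∈ (a∈ j))
                            (λ eq → A.tail≢head (a∈ j) (trans (sym eq) (b≡ j))) (λ _ ()) nil
            ; start     = here (b∈ᵉ j)
            ; clear     = λ { (here x∈e) x∈old → A.clear (a∈ j) (lose x∈old x∈e) }
            ; seen      = λ { (here x∈e) → edge⊆Xs j (∈-vertices⁺ x∈e) }
            ; end-seen  = edge⊆Xs j (∈-vertices⁺ (A.tail∈ (a∈ j)))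
            ; stem-seen = stem⊆Xs j ∘ ∈-vertices⁺
            ; own       = λ { (here x∈e) → stem-meet (A.tail∈top (a∈ j)) (A.edge∈ (a∈ j))
                              (A.clear (a∈ j)) (A.tail∈ (a∈ j)) x∈e }
            }
        ; near    = λ where
            true  → ≤-trans (≤-reflexive (η-refl _)) z≤n
            false → ≤-reflexive (η-sym _ _)
        }
        where
        s₀ = vertices (stem (y true))
        s₁ = vertices (stem (y false))
        e₀ = vertices (edge (a true))
        e₁ = vertices (edge (a false))
        Xs = s₀ ++ s₁ ++ e₀ ++ e₁
        b≡ : ∀ j → head (a true) ≡ head (a j)
        b≡ true  = refl
        b≡ false = same-head
        b∈ᵉ : ∀ j → head (a true) ∈ˢ edge (a j)
        b∈ᵉ j = subst (_∈ˢ edge (a j)) (sym (b≡ j)) (A.head∈ (a∈ j))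
        edge⊆Xs : ∀ j {x} → x ∈ vertices (edge (a j)) → x ∈ Xs
        edge⊆Xs true  = ∈-++⁺ʳ s₀ ∘ ∈-++⁺ʳ s₁ ∘ ∈-++⁺ˡ
        edge⊆Xs false = ∈-++⁺ʳ s₀ ∘ ∈-++⁺ʳ s₁ ∘ ∈-++⁺ʳ e₀
        stem⊆Xs : ∀ j {x} → x ∈ vertices (stem (y j)) → x ∈ Xs
        stem⊆Xs true  = ∈-++⁺ˡ
        stem⊆Xs false = ∈-++⁺ʳ s₀ ∘ ∈-++⁺ˡ
        stem-size : ∀ j → length (vertices (stem (y j))) ≤ r
        stem-size j = ≤-trans (length-vertices (stem (y j))) (∣stem∣≤r (A.tail∈top (a∈ j)))
        size : length Xs ≤ 4 * r
        size = begin
          length Xs                             ≡⟨ length-++ s₀ ⟩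
          length s₀ + length (s₁ ++ e₀ ++ e₁)   ≡⟨ cong (length s₀ +_) (length-++ s₁) ⟩
          length s₀ + (length s₁ + length (e₀ ++ e₁))
            ≡⟨ cong (λ t → length s₀ + (length s₁ + t)) (length-++ e₀) ⟩
          length s₀ + (length s₁ + (length e₀ + length e₁))
            ≤⟨ +-mono-≤ (stem-size true) (+-mono-≤ (stem-size false)
                 (+-mono-≤ (length-vertices-edge (a∈ true)) (length-vertices-edge (a∈ false)))) ⟩
          r + (r + (r + r))                     ≡⟨ arith r ⟩
          4 * r                                 ∎
          where
          open ≤-Reasoning
          arith : ∀ r → r + (r + (r + r)) ≡ 4 * r
          arith = solve-∀

      size-step : ∀ Xs c {b} → b ∈ arcs → length Xs ≤ c * r →
                  length (Xs ++ vertices (edge b)) ≤ suc c * r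
      size-step Xs c {b} b∈ le = begin
        length (Xs ++ vertices (edge b))         ≡⟨ length-++ Xs ⟩
        length Xs + length (vertices (edge b))   ≤⟨ +-mono-≤ le (length-vertices-edge b∈) ⟩
        c * r + r                                ≡⟨ +-comm (c * r) r ⟩
        suc c * r                                ∎
        where open ≤-Reasoning

      -- The new tail stays within `h` of both `y j`: the arcs `b` and `b′` share a head, so
      -- `widest` bounds the height between their tails, and the ultrametric inequality combines
      -- this with the bound for `tail b` without loss.
      to-tail : ∀ {m} → m < k → AtHead m → AtTail m
      to-tail {m} m<k w = record
        { Xs      = Xs ++ vertices (edge b′)
        ; Xs-size = size-step Xs (4 + 2 * m) b′∈ Xs-size
        ; b∈      = b′∈
        ; R       = λ j → edge b′ ∷ R j
        ; R-size  = λ j → cong suc (R-size j)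
        ; strand  = λ j → extend (strand j) (A.edge∈ b′∈) (A.clear b′∈)
                      (subst (_∈ˢ edge b′) hd (A.head∈ b′∈)) (A.tail∈ b′∈) tail≢ (fit ∘ ∈-++⁺ˡ)
        ; near    = λ j → ≤-trans (η-ultra (y j) (tail b) (tail b′))
                      (⊔-lub (near j) (widest b∈ b′∈ (sym hd)))
        ; fresh   = λ j eq → tail≢ (fit (∈-++⁺ˡ (subst (_∈ Xs) eq (Strand.end-seen (strand j)))) (A.tail∈ b′∈))
        ; own     = λ where
            j (here x∈e) → stem-meet (A.tail∈top b′∈) (A.edge∈ b′∈) (A.clear b′∈) (A.tail∈ b′∈) x∈e
            -- A walked vertex `x` on the new stem would have `tail b′` as its owner; then `tail b′`
            -- belongs to `Y` and, by `fit`, equals the head.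
            j (there x∈R) x∈stem → contradiction
              (fit (∈-++⁺ʳ Xs (subst (_∈ map owner Xs)
                     (owner-stem (A.tail∈top b′∈) x∈stem (Strand.clear (strand j) x∈R))
                     (∈-map⁺ owner (Strand.seen (strand j) x∈R))))
                   (A.tail∈ b′∈))
              tail≢
        }
        where
        open AtHead w
        Y = Xs ++ map owner Xs
        -- The seen vertices and their owners number at most `2 * (4 + 2 * m) * r`, which is
        -- `4 * ((m + 2) * r)`; with `m < k` this is the origin of the bound `4 * (suc k * r)` on
        -- `d`.
        Y-size : length Y ≤ d
        Y-size = begin
          length Y                                    ≡⟨ length-++ Xs ⟩
          length Xs + length (map owner Xs)           ≡⟨ cong (length Xs +_) (length-map owner Xs) ⟩
          length Xs + length Xs                       ≤⟨ +-mono-≤ Xs-size Xs-size ⟩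
          (4 + 2 * m) * r + (4 + 2 * m) * r           ≡⟨ arith m r ⟩
          4 * (suc (suc m) * r)                       ≤⟨ *-monoʳ-≤ 4 (*-monoˡ-≤ r (s≤s m<k)) ⟩
          4 * (suc k * r)                             ≤⟨ d-large ⟩
          d                                           ∎
          where
          open ≤-Reasoning
          arith : ∀ m r → (4 + 2 * m) * r + (4 + 2 * m) * r ≡ 4 * (suc (suc m) * r)
          arith = solve-∀
        picked = pickHead b∈ Y Y-size
        b′ = proj₁ picked
        b′∈ : b′ ∈ arcs
        b′∈ = proj₁ (proj₂ picked)
        hd : head b′ ≡ head b
        hd = proj₁ (proj₂ (proj₂ picked))
        fit : ∀ {x} → x ∈ Y → x ∈ˢ edge b′ → x ≡ head b
        fit = proj₂ (proj₂ (proj₂ picked))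
        tail≢ : tail b′ ≢ head b
        tail≢ eq = A.tail≢head b′∈ (trans eq (sym hd))

      -- The tail does not change, so nearness is inherited; no further stem comes in, so avoiding
      -- `Xs` suffices.
      to-head : ∀ {m} → suc m < k → AtTail m → AtHead (suc m)
      to-head {m} m<k w = record
        { Xs      = Xs ++ vertices (edge b′)
        ; Xs-size = ≤-trans (size-step Xs (5 + 2 * m) b′∈ Xs-size) (≤-reflexive (cong (_* r) (arith₁ m)))
        ; b∈      = b′∈
        ; R       = λ j → edge b′ ∷ R j
        ; R-size  = λ j → trans (cong suc (R-size j)) (arith₂ m)
        ; strand  = λ j → extend (strand j) (A.edge∈ b′∈) (A.clear b′∈)
                      (subst (_∈ˢ edge b′) tl (A.tail∈ b′∈)) (A.head∈ b′∈)
                      (λ eq → A.tail≢head b′∈ (trans tl (sym eq))) fit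
        ; near    = λ j → subst (λ t → η (y j) t ≤ h) (sym tl) (near j)
        }
        where
        open AtTail w
        arith₁ : ∀ m → 6 + 2 * m ≡ 4 + 2 * suc m
        arith₁ = solve-∀
        arith₂ : ∀ m → 3 + 2 * m ≡ 1 + 2 * suc m
        arith₂ = solve-∀
        Xs≤d : length Xs ≤ d
        Xs≤d = begin
          length Xs                         ≤⟨ Xs-size ⟩
          (5 + 2 * m) * r                   ≤⟨ m≤m+n _ ((7 + 2 * m) * r) ⟩
          (5 + 2 * m) * r + (7 + 2 * m) * r ≡⟨ arith m r ⟩
          4 * (suc (suc (suc m)) * r)       ≤⟨ *-monoʳ-≤ 4 (*-monoˡ-≤ r (s≤s m<k)) ⟩
          4 * (suc k * r)                   ≤⟨ d-large ⟩
          d                                 ∎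
          where
          open ≤-Reasoning
          arith : ∀ m r → (5 + 2 * m) * r + (7 + 2 * m) * r ≡ 4 * (suc (suc (suc m)) * r)
          arith = solve-∀
        picked = pickTail b∈ Xs Xs≤d
        b′ = proj₁ picked
        b′∈ : b′ ∈ arcs
        b′∈ = proj₁ (proj₂ picked)
        tl : tail b′ ≡ tail b
        tl = proj₁ (proj₂ (proj₂ picked))
        fit : ∀ {x} → x ∈ Xs → x ∈ˢ edge b′ → x ≡ tail b
        fit = proj₂ (proj₂ (proj₂ picked))

      walk : ∀ m → m < k → AtTail m
      walk zero    m<k = to-tail m<k begin-walk
      walk (suc m) m<k = to-tail m<k (to-head m<k (walk m (<-trans (n<1+n m) m<k)))

      -- h ≤ η (y true) z ⊔ η z (y false), while neither term exceeds h.
      cycle : ∀ m → m < k → Cycle G (2 * h + 2 * suc m)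
      cycle m m<k = [ use true , use false ]′ attained
        where
        open AtTail (walk m m<k)
        attained : η (y true) (tail b) ≡ h ⊎ η (y false) (tail b) ≡ h
        attained with ⊔-sel (η (y true) (tail b)) (η (tail b) (y false))
        ... | inj₁ eq = inj₁ (≤-antisym (near true)
          (subst (h ≤_) eq (η-ultra (y true) (tail b) (y false))))
        ... | inj₂ eq = inj₂ (≤-antisym (near false)
          (subst (h ≤_) (trans eq (η-sym _ _)) (η-ultra (y true) (tail b) (y false))))
        arith : ∀ m h → 2 + 2 * m + 2 * h ≡ 2 * h + 2 * suc m
        arith = solve-∀
        use : ∀ j → η (y j) (tail b) ≡ h → Cycle G (2 * h + 2 * suc m)
        use j eq = subst (Cycle G)
          (trans (cong₂ (λ l t → l + 2 * t) (R-size j) eq) (arith m h))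
          (close (strand j) (A.tail∈top (a∈ j)) (A.tail∈top b∈) (fresh j) (own j))

    cycles : 0 < r → 0 < length arcs → ∃[ h ] 0 < h × h ≤ i × (∀ m → m < k → Cycle G (2 * h + 2 * suc m))
    cycles 0<r 0<arcs = h , 0<h , η≤i _ _ , cycle
      where
      open import Data.List.Extrema ≤-totalOrder using (argmax; f[xs]≤f[argmax]; argmax-sel)
      first : ∃[ a ] a ∈ arcs
      first = go arcs 0<arcs
        where
        go : ∀ as → 0 < length as → ∃[ a ] a ∈ as
        go (a ∷ as) _ = a , here refl
      a₀ = proj₁ first
      a₀∈ = proj₂ first
      1≤d : 1 ≤ d
      1≤d = ≤-trans (*-mono-≤ {1} {4} (s≤s z≤n) (*-mono-≤ {1} {suc k} (s≤s z≤n) 0<r)) d-large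
      -- A second arc with the same head but another tail gives a pair of positive width, so the
      -- maximal height is positive and the tails attaining it differ.
      second = pickHead a₀∈ (tail a₀ ∷ []) 1≤d
      a₁ = proj₁ second
      a₁∈ = proj₁ (proj₂ second)
      hd : head a₁ ≡ head a₀
      hd = proj₁ (proj₂ (proj₂ second))
      tails≢ : tail a₀ ≢ tail a₁
      tails≢ eq = A.tail≢head a₀∈ (proj₂ (proj₂ (proj₂ second)) (here refl)
        (subst (_∈ˢ edge a₁) (sym eq) (A.tail∈ a₁∈)))
      sameHead? : Decidable (λ (ab : Arc n × Arc n) → head (proj₁ ab) ≡ head (proj₂ ab))
      sameHead? (a , b) = head a ≟ head b
      pairs = filter sameHead? (cartesianProduct arcs arcs)
      width : Arc n × Arc n → ℕ
      width (a , b) = η (tail a) (tail b)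
      best = argmax width (a₀ , a₁) pairs
      ∈pairs : ∀ {b c} → b ∈ arcs → c ∈ arcs → head b ≡ head c → (b , c) ∈ pairs
      ∈pairs b∈ c∈ eq = ∈-filter⁺ sameHead? (∈-cartesianProduct⁺ b∈ c∈) eq
      best∈ : best ∈ pairs
      best∈ with argmax-sel width (a₀ , a₁) pairs
      ... | inj₁ eq = subst (_∈ pairs) (sym eq) (∈pairs a₀∈ a₁∈ (sym hd))
      ... | inj₂ b∈ = b∈
      widest : ∀ {b c} → b ∈ arcs → c ∈ arcs → head b ≡ head c → η (tail b) (tail c) ≤ width best
      widest b∈ c∈ eq = All.lookup (f[xs]≤f[argmax] (a₀ , a₁) pairs) (∈pairs b∈ c∈ eq)
      0<h : 0 < width best
      0<h = <-≤-trans (η-pos (A.tail∈top a₀∈) (A.tail∈top a₁∈) tails≢) (widest a₀∈ a₁∈ (sym hd))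
      best∈arcs = ∈-cartesianProduct⁻ arcs arcs (proj₁ (∈-filter⁻ sameHead? {xs = cartesianProduct arcs arcs} best∈))
      pair : Bool → Arc n
      pair true  = proj₁ best
      pair false = proj₂ best
      pair∈ : ∀ j → pair j ∈ arcs
      pair∈ true  = proj₁ best∈arcs
      pair∈ false = proj₂ best∈arcs
      same-head : head (pair true) ≡ head (pair false)
      same-head = proj₂ (∈-filter⁻ sameHead? {xs = cartesianProduct arcs arcs} best∈)
      distinct-tails : tail (pair true) ≢ tail (pair false)
      distinct-tails eq = <⇒≢ 0<h (sym (trans (cong (λ t → η t (tail (proj₂ best))) eq) (η-refl _)))
      open Widest pair pair∈ same-head distinct-tails widest

-- The next level

module Growth {r n : ℕ} {G : RGraph r n} (linear : Linear G) (2≤r : 2 ≤ r) where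

  private
    E = edges G

  record Twig : Set where
    constructor twig
    field
      edge         : Subset n
      parent child : Fin n

  open Twig

  New : Twig → Fin n → Set
  New m x = x ∈ˢ edge m × x ≢ parent m

  new? : ∀ m → Decidable (New m)
  new? m x = (x ∈? edge m) ×-dec ¬? (x ≟ parent m)

  shoots : Twig → List (Fin n)
  shoots m = filter (new? m) (allFin n)

  Fits : List (Fin n) → Subset n → Fin n → Set
  Fits xs e v = All (λ x → x ∈ˢ e → x ≡ v) xs

  fits? : ∀ xs e v → Dec (Fits xs e v)
  fits? xs e v = All.all? (λ x → (x ∈? e) →-dec (x ≟ v)) xs

  ∈-shoots⁺ : ∀ m {x} → New m x → x ∈ shoots m
  ∈-shoots⁺ m {x} = ∈-filter⁺ (new? m) (∈-allFin x)

  ∈-shoots⁻ : ∀ m {x} → x ∈ shoots m → New m x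
  ∈-shoots⁻ m x∈ = proj₂ (∈-filter⁻ (new? m) {xs = allFin n} x∈)

  allShoots : List Twig → List (Fin n)
  allShoots []      = []
  allShoots (m ∷ M) = shoots m ++ allShoots M

  ∈-allShoots : ∀ {M m x} → m ∈ M → New m x → x ∈ allShoots M
  ∈-allShoots {m ∷ M} (here refl) nw = ∈-++⁺ˡ (∈-shoots⁺ m nw)
  ∈-allShoots {m ∷ M} (there m∈)  nw = ∈-++⁺ʳ (shoots m) (∈-allShoots m∈ nw)

  -- The default makes the stem, the owner and the height of the next tree total. It is never
  -- reached at a new vertex of a listed twig, and the laws of `height` hold for any assignment of
  -- twigs.
  find-twig : List Twig → Fin n → Twig
  find-twig []      x = twig Subset.⊥ x x
  find-twig (m ∷ M) x with new? m x
  ... | yes _ = m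
  ... | no _  = find-twig M x

  Disjoint : Twig → Twig → Set
  Disjoint m m′ = ∀ {x} → New m x → ¬ New m′ x

  find-twig-≡ : ∀ {M m x} → AllPairs Disjoint M → m ∈ M → New m x → find-twig M x ≡ m
  find-twig-≡ {m′ ∷ M} {m} {x} (dis ∷ diss) m∈ nw with new? m′ x | m∈
  ... | yes _   | here refl = refl
  ... | yes nw′ | there m∈M = contradiction nw (All.lookup dis m∈M nw′)
  ... | no ¬nw  | here refl = contradiction nw ¬nw
  ... | no _    | there m∈M = find-twig-≡ diss m∈M nw

  other-vertex : ∀ {e} → e ∈ E → ∀ v → ∃[ x ] x ∈ˢ e × x ≢ v
  other-vertex {e} e∈ v with any? (new? (twig e v v)) (allFin n)
  ... | yes some = let x , _ , nw = find some in x , nw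
  ... | no none = contradiction
    (≤-trans 2≤r (≤-trans (≤-reflexive (sym (All.lookup (uniform G) e∈)))
      (≤-trans (Subsetₚ.p⊆q⇒∣p∣≤∣q∣ {p = e} {q = ⁅ v ⁆} e⊆) (≤-reflexive (∣⁅x⁆∣≡1 v)))))
    λ { (s≤s ()) }
    where
    e⊆ : ∀ {x} → x ∈ˢ e → x ∈ˢ ⁅ v ⁆
    e⊆ {x} x∈e with x ≟ v
    ... | yes refl = x∈⁅x⁆ v
    ... | no x≢v = contradiction (lose (∈-allFin x) (x∈e , x≢v)) none

  module _ {i : ℕ} (tree : Tree G i) where

    open Tree tree

    occupied : List (Fin n)
    occupied = old ++ new

    record IsTwig (m : Twig) : Set where
      field
        edge∈      : edge m ∈ E
        parent∈top : parent m ∈ top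
        parent∈    : parent m ∈ˢ edge m
        child-new  : New m (child m)
        fits       : ∀ {x} → x ∈ occupied → x ∈ˢ edge m → x ≡ parent m
        heaviest   : ∀ {x} → New m x → degree E x ≤ degree E (child m)

    -- `maximal` supplies the head of every arc. It covers the chosen edges as well, through their
    -- own new vertices, so frontier edges need no case distinction.
    record Matching (es : List (Subset n)) : Set where
      field
        twigs    : List Twig
        isTwig   : ∀ {m} → m ∈ twigs → IsTwig m
        disjoint : AllPairs Disjoint twigs
        maximal  : ∀ {e v} → e ∈ es → v ∈ top → v ∈ˢ e →
                   ∃[ x ] x ∈ occupied ++ allShoots twigs × x ∈ˢ e × x ≢ v

    heaviest-child : ∀ {e} → e ∈ E → ∀ v →
      ∃[ u ] New (twig e v v) u × (∀ {x} → New (twig e v v) x → degree E x ≤ degree E u)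
    heaviest-child {e} e∈ v = u , u-new , λ nw →
      All.lookup (f[xs]≤f[argmax] x₀ (shoots m)) (∈-shoots⁺ m nw)
      where
      open import Data.List.Extrema ≤-totalOrder using (argmax; f[xs]≤f[argmax]; argmax-sel)
      m = twig e v v
      x₀ = proj₁ (other-vertex e∈ v)
      u = argmax (degree E) x₀ (shoots m)
      u-new : New m u
      u-new with argmax-sel (degree E) x₀ (shoots m)
      ... | inj₁ eq = subst (New m) (sym eq) (proj₂ (other-vertex e∈ v))
      ... | inj₂ u∈ = ∈-shoots⁻ m u∈

    -- Greedy choice along the list: an edge that is skipped has a second vertex among those already
    -- taken, and that set only grows.
    matching : ∀ es → (∀ {e} → e ∈ es → e ∈ E) → Matching es
    matching [] _ = record { twigs = [] ; isTwig = λ () ; disjoint = [] ; maximal = λ () }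
    matching (e ∷ es) es⊆ with matching es (es⊆ ∘ there)
    ... | M with any? (λ v → (v ∈? e) ×-dec fits? (occupied ++ allShoots (Matching.twigs M)) e v) top
    ... | no none = record
      { twigs    = twigs
      ; isTwig   = isTwig
      ; disjoint = disjoint
      ; maximal  = λ where
          (here refl) v∈top v∈e →
            let x , x∈ , ¬ok = find (¬All⇒Any¬ (λ x → (x ∈? e) →-dec (x ≟ _)) _
                                      (λ fit → none (lose v∈top (v∈e , fit))))
            in x , x∈ , decidable-stable (x ∈? e) (λ x∉ → ¬ok λ x∈ → contradiction x∈ x∉)
                 , λ x≡v → ¬ok λ _ → x≡v
          (there e∈) → maximal e∈
      }
      where open Matching M
    ... | yes some with find some
    ...   | v , v∈top , v∈e , fit with heaviest-child (es⊆ (here refl)) v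
    ...     | u , u-new , u-max = record
      { twigs    = m ∷ twigs
      ; isTwig   = λ where
          (here refl) → record
            { edge∈ = e∈E ; parent∈top = v∈top ; parent∈ = v∈e ; child-new = u-new
            ; fits = λ x∈ → All.lookup fit (∈-++⁺ˡ x∈) ; heaviest = u-max }
          (there m∈) → isTwig m∈
      ; disjoint = All.tabulate (λ m′∈ (x∈e , x≢v) nw′ →
          x≢v (All.lookup fit (∈-++⁺ʳ occupied (∈-allShoots m′∈ nw′)) x∈e)) ∷ disjoint
      ; maximal  = λ where
          (here refl) w∈top w∈e →
            -- For the edge just taken the witness is its child `u`. If `u` were in the top it would
            -- be occupied, and `fit` would make it the parent.
            u , ∈-++⁺ʳ occupied (∈-++⁺ˡ (∈-shoots⁺ m u-new)) , proj₁ u-new , λ where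
              refl → proj₂ u-new (All.lookup fit (∈-++⁺ˡ (∈-++⁺ʳ old (top⊆new w∈top))) w∈e)
          (there e′∈) w∈top w∈e →
            let x , x∈ , rest = maximal e′∈ w∈top w∈e in x , mono x∈ , rest
      }
      where
      open Matching M
      m = twig e v u
      e∈E = es⊆ (here refl)
      mono : ∀ {x} → x ∈ occupied ++ allShoots twigs → x ∈ occupied ++ allShoots (m ∷ twigs)
      mono x∈ with ∈-++⁻ occupied x∈
      ... | inj₁ x∈occ = ∈-++⁺ˡ x∈occ
      ... | inj₂ x∈new = ∈-++⁺ʳ occupied (∈-++⁺ʳ (shoots m) x∈new)

    module Extension (M : Matching E) where

      open Matching M
      module T {m} (m∈ : m ∈ twigs) = IsTwig (isTwig m∈)

      twigOf : Fin n → Twig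
      twigOf = find-twig twigs

      -- Heights are measured from the newest level, so every distinct pair gains one over its
      -- parents; siblings have height 1.
      height : Fin n → Fin n → ℕ
      height x y with x ≟ y
      ... | yes _ = 0
      ... | no _  = suc (η (parent (twigOf x)) (parent (twigOf y)))

      height-refl : ∀ x → height x x ≡ 0
      height-refl x with x ≟ x
      ... | yes _  = refl
      ... | no x≢x = contradiction refl x≢x

      height-≢ : ∀ {x y} → x ≢ y → height x y ≡ suc (η (parent (twigOf x)) (parent (twigOf y)))
      height-≢ {x} {y} x≢y with x ≟ y
      ... | yes x≡y = contradiction x≡y x≢y
      ... | no _    = refl

      height-sym : ∀ x y → height x y ≡ height y x
      height-sym x y with x ≟ y | y ≟ x
      ... | yes _   | yes _   = refl
      ... | yes x≡y | no y≢x  = contradiction (sym x≡y) y≢x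
      ... | no x≢y  | yes y≡x = contradiction (sym y≡x) x≢y
      ... | no _    | no _    = cong suc (η-sym _ _)

      -- Off the diagonal each value is one more than an `η` of parents, so the inequality is
      -- inherited from `η-ultra`.
      height-ultra : ∀ x y z → height x z ≤ height x y ⊔ height y z
      height-ultra x y z with x ≟ y
      ... | yes refl = ≤-refl
      ... | no x≢y with y ≟ z
      ...   | yes refl = ≤-trans (≤-reflexive (height-≢ x≢y)) (m≤m⊔n _ 0)
      ...   | no _ with x ≟ z
      ...     | yes _ = z≤n
      ...     | no _  = s≤s (η-ultra _ _ _)

      height≤ : ∀ x y → height x y ≤ suc i
      height≤ x y with x ≟ y
      ... | yes _ = z≤n
      ... | no _  = s≤s (η≤i _ _)

      top′ : List (Fin n)
      top′ = map child twigs

      ∈-top′ : ∀ {y} → y ∈ top′ → ∃[ m ] m ∈ twigs × child m ≡ y × twigOf y ≡ m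
      ∈-top′ y∈ with ∈-map⁻ child y∈
      ... | m , m∈ , refl = m , m∈ , refl , find-twig-≡ disjoint m∈ (T.child-new m∈)

      parent∈occupied : ∀ {m} → m ∈ twigs → parent m ∈ occupied
      parent∈occupied m∈ = ∈-++⁺ʳ old (top⊆new (T.parent∈top m∈))

      -- The new vertices of different twigs are disjoint, and a parent is occupied, so by `fits` it
      -- lies on another twig only as the parent of that one.
      common : ∀ {m m′ z} → m ∈ twigs → m′ ∈ twigs → child m ≢ child m′ →
               z ∈ˢ edge m → z ∈ˢ edge m′ → z ≡ parent m × z ≡ parent m′
      common {m} {m′} {z} m∈ m′∈ c≢c′ z∈m z∈m′ with z ≟ parent m | z ≟ parent m′
      ... | yes refl | _        = refl , T.fits m′∈ (parent∈occupied m∈) z∈m′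
      ... | no _     | yes refl = T.fits m∈ (parent∈occupied m′∈) z∈m , refl
      ... | no z≢p   | no z≢p′  = contradiction
        (cong child (trans (sym (find-twig-≡ disjoint m∈ (z∈m , z≢p))) (find-twig-≡ disjoint m′∈ (z∈m′ , z≢p′))))
        c≢c′

      -- Siblings are joined by their two twigs. Otherwise the path between the parents is occupied,
      -- so each twig meets it only at its parent and can be attached at that end.
      link′ : ∀ {x y} → x ∈ top′ → y ∈ top′ → x ≢ y →
        ∃[ es ] Path G x es y × length es ≡ 2 * height x y ×
        (∀ {z} → z ∈ᵛ es → z ∈ occupied ⊎ z ∈ˢ edge (twigOf x) ⊎ z ∈ˢ edge (twigOf y))
      link′ x∈ y∈ x≢y with ∈-top′ x∈ | ∈-top′ y∈
      ... | m , m∈ , refl , eq | m′ , m′∈ , refl , eq′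
        rewrite height-≢ x≢y | eq | eq′ with parent m ≟ parent m′
      ... | yes p≡p′ = edge m ∷ edge m′ ∷ []
        , cons (T.edge∈ m∈) (proj₁ (T.child-new m∈)) (T.parent∈ m∈) (proj₂ (T.child-new m∈))
            (λ { z∈m (here z∈m′) → proj₁ (common m∈ m′∈ x≢y z∈m z∈m′) })
            (cons (T.edge∈ m′∈) (subst (_∈ˢ edge m′) (sym p≡p′) (T.parent∈ m′∈))
              (proj₁ (T.child-new m′∈)) (λ eq″ → proj₂ (T.child-new m′∈) (trans (sym eq″) p≡p′)) (λ _ ()) nil)
        , cong (λ t → 2 * suc t) (sym (trans (cong (η (parent m)) (sym p≡p′)) (η-refl (parent m))))
        , λ { (here z∈m) → inj₂ (inj₁ z∈m) ; (there (here z∈m′)) → inj₂ (inj₂ z∈m′) }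
      ... | no p≢p′ with link (T.parent∈top m∈) (T.parent∈top m′∈) p≢p′
      ...   | es , path , len , es⊆ = edge m ∷ es ++ edge m′ ∷ []
        , cons (T.edge∈ m∈) (proj₁ (T.child-new m∈)) (T.parent∈ m∈) (proj₂ (T.child-new m∈)) meet
            (path-++ path (cons (T.edge∈ m′∈) (T.parent∈ m′∈) (proj₁ (T.child-new m′∈))
                             (λ eq″ → proj₂ (T.child-new m′∈) (sym eq″)) (λ _ ()) nil)
              λ { z∈es (here z∈m′) → T.fits m′∈ (es⊆occupied z∈es) z∈m′ })
        , trans (cong suc (trans (length-++ es) (cong (_+ 1) len))) (arith (η (parent m) (parent m′)))
        , λ where
            (here z∈m)   → inj₂ (inj₁ z∈m)
            (there z∈) → case ++⁻ es z∈ of λ where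
              (inj₁ z∈es)        → inj₁ (es⊆occupied z∈es)
              (inj₂ (here z∈m′)) → inj₂ (inj₂ z∈m′)
        where
        arith : ∀ t → suc (2 * t + 1) ≡ 2 * suc t
        arith = solve-∀
        stem⊆occupied : ∀ {p z} → p ∈ top → z ∈ˢ stem p → z ∈ occupied
        stem⊆occupied p∈ z∈ with stem⊆ p∈ z∈
        ... | inj₁ z∈old = ∈-++⁺ˡ z∈old
        ... | inj₂ z∈new = ∈-++⁺ʳ old z∈new
        es⊆occupied : ∀ {z} → z ∈ᵛ es → z ∈ occupied
        es⊆occupied z∈ with es⊆ z∈
        ... | inj₁ z∈old         = ∈-++⁺ˡ z∈old
        ... | inj₂ (inj₁ z∈stem) = stem⊆occupied (T.parent∈top m∈) z∈stem
        ... | inj₂ (inj₂ z∈stem) = stem⊆occupied (T.parent∈top m′∈) z∈stem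
        meet : ∀ {z} → z ∈ˢ edge m → z ∈ᵛ es ++ edge m′ ∷ [] → z ≡ parent m
        meet z∈m z∈ with ++⁻ es z∈
        ... | inj₁ z∈es        = T.fits m∈ (es⊆occupied z∈es) z∈m
        ... | inj₂ (here z∈m′) = proj₁ (common m∈ m′∈ x≢y z∈m z∈m′)

      next : Tree G (suc i)
      next = record
        { top        = top′
        ; new        = allShoots twigs
        ; old        = occupied
        ; stem       = edge ∘ twigOf
        ; owner      = child ∘ twigOf
        ; η          = height
        ; top!       = AllPairsₚ.map⁺ (distinct disjoint isTwig)
        ; top⊆new    = λ y∈ → case ∈-top′ y∈ of λ { (m , m∈ , refl , _) → ∈-allShoots m∈ (T.child-new m∈) }
        ; stem-meet  = stem-meet′
        ; ∣stem∣≤r   = λ y∈ → case ∈-top′ y∈ of λ { (m , m∈ , refl , eq) →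
                         ≤-reflexive (All.lookup (uniform G) (subst (λ t → edge t ∈ E) (sym eq) (T.edge∈ m∈))) }
        ; stem⊆      = stem⊆′
        ; owner-stem = owner-stem′
        ; η-refl     = height-refl
        ; η-sym      = height-sym
        ; η-ultra    = height-ultra
        ; η≤i        = height≤
        ; η-pos      = λ _ _ x≢y → ≤-trans (s≤s z≤n) (≤-reflexive (sym (height-≢ x≢y)))
        ; link       = link′
        }
        where
        distinct : ∀ {M} → AllPairs Disjoint M → (∀ {m} → m ∈ M → IsTwig m) →
                   AllPairs (λ m m′ → child m ≢ child m′) M
        distinct [] _ = []
        distinct {m ∷ M} (dis ∷ diss) ok = All.tabulate (λ {m′} m′∈ eq →
          All.lookup dis m′∈ (IsTwig.child-new (ok (here refl)))
            (subst (New m′) (sym eq) (IsTwig.child-new (ok (there m′∈))))) ∷ distinct diss (ok ∘ there)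
        stem-meet′ : ∀ {x y e} → y ∈ top′ → e ∈ E → ¬ Meets occupied e → y ∈ˢ e →
                     x ∈ˢ e → x ∈ˢ edge (twigOf y) → x ≡ y
        stem-meet′ {e = e} y∈ e∈ avoids y∈e x∈e x∈stem with ∈-top′ y∈
        ... | m , m∈ , refl , eq rewrite eq =
          -- The stem contains an occupied parent while `e` avoids `occupied`, so the two edges
          -- differ and share only `y`.
          twoCommon⇒≡ {G = G} linear e∈ (T.edge∈ m∈)
            (λ { refl → avoids (lose (parent∈occupied m∈) (T.parent∈ m∈)) })
            x∈e x∈stem y∈e (proj₁ (T.child-new m∈))
        stem⊆′ : ∀ {x y} → y ∈ top′ → x ∈ˢ edge (twigOf y) → x ∈ occupied ⊎ x ∈ allShoots twigs
        stem⊆′ {x} y∈ x∈ with ∈-top′ y∈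
        ... | m , m∈ , refl , eq rewrite eq with x ≟ parent m
        ...   | yes refl = inj₁ (parent∈occupied m∈)
        ...   | no x≢p   = inj₂ (∈-allShoots m∈ (x∈ , x≢p))
        owner-stem′ : ∀ {x y} → y ∈ top′ → x ∈ˢ edge (twigOf y) → ¬ x ∈ occupied → child (twigOf x) ≡ y
        owner-stem′ y∈ x∈ x∉ with ∈-top′ y∈
        ... | m , m∈ , refl , eq rewrite eq =
          cong child (find-twig-≡ disjoint m∈ (x∈ , λ { refl → x∉ (parent∈occupied m∈) }))

      length-shoots : ∀ {m} → m ∈ twigs → length (shoots m) ≤ r
      length-shoots {m} m∈ = ≤-trans
        (unique⇒length≤∣p∣ (Uniqueₚ.filter⁺ (new? m) (Uniqueₚ.allFin⁺ n)) (proj₁ ∘ ∈-shoots⁻ m))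
        (≤-reflexive (All.lookup (uniform G) (T.edge∈ m∈)))

      length-allShoots : length (allShoots twigs) ≤ r * length top′
      length-allShoots = go twigs length-shoots
        where
        go : ∀ M → (∀ {m} → m ∈ M → length (shoots m) ≤ r) → length (allShoots M) ≤ r * length (map child M)
        go [] _ = z≤n
        go (m ∷ M) ok = ≤-trans (≤-reflexive (length-++ (shoots m)))
          (≤-trans (+-mono-≤ (ok (here refl)) (go M (ok ∘ there))) (≤-reflexive (sym (*-suc r _))))

      -- The reason for extending only a child of largest degree: all of the at most `r` new
      -- vertices of a twig are charged to it.
      Δ-allShoots : Δ E (allShoots twigs) ≤ r * Δ E top′
      Δ-allShoots = go twigs λ m∈ → length-shoots m∈ , T.heaviest m∈
        where
        Δ-bound : ∀ xs {b} → (∀ {x} → x ∈ xs → degree E x ≤ b) → Δ E xs ≤ length xs * b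
        Δ-bound [] _ = z≤n
        Δ-bound (x ∷ xs) ok = +-mono-≤ (ok (here refl)) (Δ-bound xs (ok ∘ there))
        Δ-++ : ∀ xs ys → Δ E (xs ++ ys) ≡ Δ E xs + Δ E ys
        Δ-++ xs ys = trans (cong sum (map-++ (degree E) xs ys)) (sum-++ (map (degree E) xs) _)
        go : ∀ M → (∀ {m} → m ∈ M → length (shoots m) ≤ r × (∀ {x} → New m x → degree E x ≤ degree E (child m))) →
             Δ E (allShoots M) ≤ r * Δ E (map child M)
        go [] _ = z≤n
        go (m ∷ M) ok = begin
          Δ E (shoots m ++ allShoots M)             ≡⟨ Δ-++ (shoots m) (allShoots M) ⟩
          Δ E (shoots m) + Δ E (allShoots M)        ≤⟨ +-mono-≤ (Δ-bound (shoots m) (proj₂ (ok (here refl)) ∘ ∈-shoots⁻ m)) (go M (ok ∘ there)) ⟩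
          length (shoots m) * degree E (child m) + r * Δ E (map child M)
            ≤⟨ +-monoˡ-≤ _ (*-monoˡ-≤ (degree E (child m)) (proj₁ (ok (here refl)))) ⟩
          r * degree E (child m) + r * Δ E (map child M)
            ≡⟨ *-distribˡ-+ r (degree E (child m)) _ ⟨
          r * Δ E (map child (m ∷ M))               ∎
          where open ≤-Reasoning

-- Exploration up to the first dense level

^-distribʳ-* : ∀ n a b → (a * b) ^ n ≡ a ^ n * b ^ n
^-distribʳ-* zero    a b = refl
^-distribʳ-* (suc n) a b = trans (cong (a * b *_) (^-distribʳ-* n a b)) (arith a b (a ^ n) (b ^ n))
  where
  arith : ∀ a b c d → a * b * (c * d) ≡ a * c * (b * d)
  arith = solve-∀

n<2^n : ∀ n → n < 2 ^ n
n<2^n zero    = s≤s z≤n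
n<2^n (suc n) = ≤-trans (s≤s (n<2^n n))
  (≤-trans (+-monoˡ-≤ (2 ^ n) (m^n>0 2 n)) (≤-reflexive (cong (2 ^ n +_) (sym (+-identityʳ (2 ^ n))))))

FoundCycles : ∀ {r n} → RGraph r n → (k i : ℕ) → Set
FoundCycles G k i = ∃[ h ] 0 < h × h ≤ i × (∀ m → m < k → Cycle G (2 * h + 2 * suc m))

module Exploration {r n : ℕ} {G : RGraph r n} (linear : Linear G) (2≤r : 2 ≤ r)
  (k d δ : ℕ) (d-large : 4 * (suc k * r) ≤ d) (δ-large : 24 * (d * (r * r * (r * r))) ≤ δ)
  (min-degree : ∀ {e x} → e ∈ edges G → x ∈ˢ e → δ ≤ degree (edges G) x)
  where

  open Growth {G = G} linear 2≤r
  open Tree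
  open Arc

  private
    E = edges G

  record Thick {i} (tree : Tree G i) : Set where
    field
      top-degree : ∀ {x} → x ∈ top tree → δ ≤ degree E x
      ∣new∣      : length (new tree) ≤ r * length (top tree)
      Δ-new      : Δ E (new tree) ≤ r * Δ E (top tree)
      Δ-old      : 2 * r * Δ E (old tree) ≤ Δ E (top tree)

  δ*length≤Δ : ∀ xs → (∀ {x} → x ∈ xs → δ ≤ degree E x) → δ * length xs ≤ Δ E xs
  δ*length≤Δ [] _ = ≤-reflexive (*-zeroʳ δ)
  δ*length≤Δ (x ∷ xs) ok = ≤-trans (≤-reflexive (*-suc δ (length xs)))
    (+-mono-≤ (ok (here refl)) (δ*length≤Δ xs (ok ∘ there)))

  Growing : ∀ {i} → Tree G i → Tree G (suc i) → Set
  Growing tree tree′ = δ * length (top tree) ≤ 8 * (d * (r * r)) * length (top tree′)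

  collect : {P : Arc n → Set} → ∀ es → (∀ {e} → e ∈ es → ∃[ v ] ∃[ x ] P (arc e v x)) →
    ∃[ arcs ] map edge arcs ≡ es × (∀ {a} → a ∈ arcs → P a)
  collect [] _ = [] , refl , λ ()
  collect (e ∷ es) f with f (here refl) | collect es (f ∘ there)
  ... | v , x , p | arcs , eq , ps = arc e v x ∷ arcs , cong (e ∷_) eq , λ where
    (here refl) → p
    (there a∈)  → ps a∈

  module Step {i} (tree : Tree G i) (thick : Thick tree) where

    open Thick thick

    M = matching tree E id
    tree′ = Extension.next tree M

    frontier? : Decidable (λ e → Meets (top tree) e × ¬ Meets (old tree) e)
    frontier? e = meets? (top tree) e ×-dec ¬? (meets? (old tree) e)

    F = filter frontier? E

    -- An edge accounts for at most `r` of the degree sum at the top. The edges that also meet `old`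
    -- account for at most half of that sum by `Δ-old`, so the frontier carries the other half.
    Δ-top≤ : Δ E (top tree) ≤ 2 * (r * length F)
    Δ-top≤ = +-cancelʳ-≤ D _ _ (begin
      D + D                               ≤⟨ +-mono-≤ bound bound ⟩
      (r * length F + r * O) + (r * length F + r * O)  ≡⟨ arith r (length F) O ⟩
      2 * (r * length F) + 2 * r * O      ≤⟨ +-monoʳ-≤ (2 * (r * length F)) Δ-old ⟩
      2 * (r * length F) + D              ∎)
      where
      open ≤-Reasoning
      D = Δ E (top tree)
      O = Δ E (old tree)
      arith : ∀ r f o → (r * f + r * o) + (r * f + r * o) ≡ 2 * (r * f) + 2 * r * o
      arith = solve-∀
      bound : D ≤ r * length F + r * O
      bound = begin
        D                                             ≤⟨ Δ≤count-meets (top! tree) (uniform G) ⟩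
        r * count (meets? (top tree)) E               ≤⟨ *-monoʳ-≤ r cover ⟩
        r * (length F + count (meets? (old tree)) E)  ≤⟨ *-monoʳ-≤ r (+-monoʳ-≤ (length F) (count-meets≤Δ E (old tree))) ⟩
        r * (length F + O)                            ≡⟨ *-distribˡ-+ r (length F) O ⟩
        r * length F + r * O                          ∎
        where
        cover : count (meets? (top tree)) E ≤ length F + count (meets? (old tree)) E
        cover = count-cover (meets? (top tree)) frontier? (meets? (old tree)) E
          λ {e} _ meets → case meets? (old tree) e of λ where
            (yes m) → inj₂ m
            (no ¬m) → inj₁ (meets , ¬m)

    ends : List (Fin n)
    ends = new tree ++ new tree′

    GoodArc : Arc n → Set
    GoodArc a = IsArc {G = G} linear tree a × head a ∈ ends

    frontier-arc : ∀ {e} → e ∈ F → ∃[ v ] ∃[ x ] GoodArc (arc e v x)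
    frontier-arc {e} e∈F with ∈-filter⁻ frontier? {xs = E} e∈F
    ... | e∈ , meets , clear with find meets
    ... | v , v∈top , v∈e with Matching.maximal M e∈ v∈top v∈e
    ... | x , x∈ , x∈e , x≢v = v , x , record
      { edge∈ = e∈ ; clear = clear ; tail∈top = v∈top ; tail∈ = v∈e ; head∈ = x∈e
      ; tail≢head = x≢v ∘ sym } , x∈ends
      where
      x∈ends : x ∈ ends
      x∈ends with ∈-++⁻ (occupied tree) x∈
      ... | inj₂ x∈new′ = ∈-++⁺ʳ (new tree) x∈new′
      ... | inj₁ x∈occ with ∈-++⁻ (old tree) x∈occ
      ...   | inj₁ x∈old = contradiction (lose x∈old x∈e) clear
      ...   | inj₂ x∈new = ∈-++⁺ˡ x∈new

    -- Tails and heads are separate labels even at the same vertex, so one run of `prune` secures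
    -- both degree conditions.
    Incident : Fin n ⊎ Fin n → Pred (Arc n) 0ℓ
    Incident (inj₁ v) a = tail a ≡ v
    Incident (inj₂ v) a = head a ≡ v

    incident? : ∀ l → Decidable (Incident l)
    incident? (inj₁ v) a = tail a ≟ v
    incident? (inj₂ v) a = head a ≟ v

    labels : List (Fin n ⊎ Fin n)
    labels = map inj₁ (top tree) ++ map inj₂ ends

    dense : length labels * d < length F → FoundCycles G k i
    dense lt with collect {P = GoodArc} F frontier-arc
    ... | arcs , eq , good with prune incident? d labels arcs
            (<-≤-trans lt (≤-reflexive (trans (cong length (sym eq)) (length-map edge arcs))))
            (AllPairsₚ.map⁻ (subst Unique (sym eq) (Uniqueₚ.filter⁺ frontier? (unique G))))
    ... | arcs′ , 0< , ⊆arcs , distinct , min =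
      Dense.cycles {G = G} linear tree k d arcs′ distinct (proj₁ ∘ good ∘ ⊆arcs)
        (λ a∈ → min (∈-++⁺ˡ (∈-map⁺ inj₁ (IsArc.tail∈top (proj₁ (good (⊆arcs a∈)))))) a∈ refl)
        (λ a∈ → min (∈-++⁺ʳ (map inj₁ (top tree)) (∈-map⁺ inj₂ (proj₂ (good (⊆arcs a∈))))) a∈ refl)
        d-large (≤-trans (s≤s z≤n) 2≤r) 0<

    module Sparse (le : length F ≤ length labels * d) where

      T T′ D : ℕ
      T  = length (top tree)
      T′ = length (top tree′)
      D  = Δ E (top tree)

      labels≤ : length labels ≤ 2 * r * (T + T′)
      labels≤ = begin
        length labels                                           ≡⟨ length-++ (map inj₁ (top tree)) ⟩
        length (map inj₁ (top tree)) + length (map inj₂ ends)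
          ≡⟨ cong₂ _+_ (length-map inj₁ (top tree)) (trans (length-map inj₂ ends) (length-++ (new tree))) ⟩
        T + (length (new tree) + length (new tree′))            ≤⟨ +-monoʳ-≤ T (+-mono-≤ ∣new∣ (Extension.length-allShoots tree M)) ⟩
        T + (r * T + r * T′)                                    ≤⟨ +-monoˡ-≤ _ (m≤m+n T _) ⟩
        (T + (T′ + 0)) + (r * T + r * T′)                       ≡⟨ arith r T T′ ⟩
        1 * (T + T′) + r * (T + T′)                             ≤⟨ +-monoˡ-≤ _ (*-monoˡ-≤ (T + T′) (≤-trans (s≤s z≤n) 2≤r)) ⟩
        r * (T + T′) + r * (T + T′)                             ≡⟨ arith₂ r (T + T′) ⟩
        2 * r * (T + T′)                                        ∎
        where
        open ≤-Reasoning
        arith : ∀ r t t′ → (t + (t′ + 0)) + (r * t + r * t′) ≡ 1 * (t + t′) + r * (t + t′)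
        arith = solve-∀
        arith₂ : ∀ r s → r * s + r * s ≡ 2 * r * s
        arith₂ = solve-∀

      δ*T≤D : δ * T ≤ D
      δ*T≤D = δ*length≤Δ (top tree) top-degree

      -- The frontier bound gives `D ≤ 4 * (d * (r * r)) * (T + T′)`. After doubling, the term in
      -- `T` is at most `δ * T ≤ D` and is absorbed by one of the two copies of `D`.
      D≤ : D ≤ 8 * (d * (r * r)) * T′
      D≤ = +-cancelˡ-≤ D _ _ (begin
        D + D                                       ≤⟨ +-mono-≤ bound bound ⟩
        c * (T + T′) + c * (T + T′)                 ≡⟨ arith d r T T′ ⟩
        8 * (d * (r * r)) * T + 8 * (d * (r * r)) * T′  ≤⟨ +-monoˡ-≤ _ (≤-trans (*-monoˡ-≤ T 8≤δ) δ*T≤D) ⟩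
        D + 8 * (d * (r * r)) * T′                  ∎)
        where
        open ≤-Reasoning
        c = 4 * (d * (r * r))
        arith : ∀ d r t t′ → 4 * (d * (r * r)) * (t + t′) + 4 * (d * (r * r)) * (t + t′) ≡
                              8 * (d * (r * r)) * t + 8 * (d * (r * r)) * t′
        arith = solve-∀
        arith₂ : ∀ d r s → 2 * (r * (2 * r * s * d)) ≡ 4 * (d * (r * r)) * s
        arith₂ = solve-∀
        bound : D ≤ c * (T + T′)
        bound = begin
          D                                   ≤⟨ Δ-top≤ ⟩
          2 * (r * length F)                  ≤⟨ *-monoʳ-≤ 2 (*-monoʳ-≤ r le) ⟩
          2 * (r * (length labels * d))       ≤⟨ *-monoʳ-≤ 2 (*-monoʳ-≤ r (*-monoˡ-≤ d labels≤)) ⟩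
          2 * (r * (2 * r * (T + T′) * d))    ≡⟨ arith₂ d r (T + T′) ⟩
          c * (T + T′)                        ∎
        8≤δ : 8 * (d * (r * r)) ≤ δ
        8≤δ = ≤-trans (*-mono-≤ {8} {24} (m≤m+n 8 16) (*-monoʳ-≤ d (begin
          r * r                ≡⟨ *-identityʳ (r * r) ⟨
          r * r * (1 * 1)      ≤⟨ *-monoʳ-≤ (r * r) (*-mono-≤ (≤-trans (s≤s z≤n) 2≤r) (≤-trans (s≤s z≤n) 2≤r)) ⟩
          r * r * (r * r)      ∎))) δ-large

      growing : Growing tree tree′
      growing = ≤-trans δ*T≤D D≤

      top′-degree : ∀ {x} → x ∈ top tree′ → δ ≤ degree E x
      top′-degree x∈ with Extension.∈-top′ tree M x∈
      ... | m , m∈ , refl , _ =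
        let ok = Matching.isTwig M m∈ in min-degree (IsTwig.edge∈ ok) (proj₁ (IsTwig.child-new ok))

      thick′ : Thick tree′
      thick′ = record
        { top-degree = top′-degree
        ; ∣new∣      = Extension.length-allShoots tree M
        ; Δ-new      = Extension.Δ-allShoots tree M
        -- The constant 24 arises here: a factor `3 * (r * r)` from the degree sums of the older and
        -- the current level, and a factor `8 * (d * (r * r))` from `D≤`.
        ; Δ-old      = begin
            2 * r * Δ E (old tree ++ new tree)           ≡⟨ cong (2 * r *_) (trans (cong sum (map-++ (degree E) (old tree) (new tree)))
                                                              (sum-++ (map (degree E) (old tree)) _)) ⟩
            2 * r * (Δ E (old tree) + Δ E (new tree))    ≡⟨ *-distribˡ-+ (2 * r) (Δ E (old tree)) _ ⟩
            2 * r * Δ E (old tree) + 2 * r * Δ E (new tree)  ≤⟨ +-mono-≤ Δ-old (*-monoʳ-≤ (2 * r) Δ-new) ⟩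
            D + 2 * r * (r * D)                          ≡⟨ cong (_+ 2 * r * (r * D)) (*-identityˡ D) ⟨
            1 * 1 * D + 2 * r * (r * D)                  ≤⟨ +-monoˡ-≤ _ (*-monoˡ-≤ D (*-mono-≤ 1≤r 1≤r)) ⟩
            r * r * D + 2 * r * (r * D)                  ≡⟨ arith r D ⟩
            3 * (r * r) * D                              ≤⟨ *-monoʳ-≤ (3 * (r * r)) D≤ ⟩
            3 * (r * r) * (8 * (d * (r * r)) * T′)       ≡⟨ arith₂ d r T′ ⟩
            24 * (d * (r * r * (r * r))) * T′            ≤⟨ *-monoˡ-≤ T′ δ-large ⟩
            δ * T′                                       ≤⟨ δ*length≤Δ (top tree′) top′-degree ⟩
            Δ E (top tree′)                              ∎
        }
        where
        open ≤-Reasoning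
        1≤r : 1 ≤ r
        1≤r = ≤-trans (s≤s z≤n) 2≤r
        arith : ∀ r t → r * r * t + 2 * r * (r * t) ≡ 3 * (r * r) * t
        arith = solve-∀
        arith₂ : ∀ d r t → 3 * (r * r) * (8 * (d * (r * r)) * t) ≡ 24 * (d * (r * r * (r * r))) * t
        arith₂ = solve-∀

    step : FoundCycles G k i ⊎ (∃[ tree′ ] Thick tree′ × Growing tree tree′)
    step with length labels * d <? length F
    ... | yes lt = inj₁ (dense lt)
    ... | no ≮   = let le = ≮⇒≥ ≮ in inj₂ (tree′ , Sparse.thick′ le , Sparse.growing le)

  -- The root has no parent edge; a singleton in its place satisfies the same laws.
  root : Fin n → Tree G 0
  root x = record
    { top        = x ∷ []
    ; new        = x ∷ []
    ; old        = []
    ; stem       = ⁅_⁆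
    ; owner      = id
    ; η          = λ _ _ → 0
    ; top!       = [] ∷ []
    ; top⊆new    = id
    ; stem-meet  = λ {_} {y} _ _ _ _ _ → x∈⁅y⁆⇒x≡y y
    ; ∣stem∣≤r   = λ {y} _ → ≤-trans (≤-reflexive (∣⁅x⁆∣≡1 y)) (≤-trans (s≤s z≤n) 2≤r)
    ; stem⊆      = λ {z} {y} y∈ z∈ → inj₂ (subst (_∈ _) (sym (x∈⁅y⁆⇒x≡y y z∈)) y∈)
    ; owner-stem = λ {_} {y} _ z∈ _ → x∈⁅y⁆⇒x≡y y z∈
    ; η-refl     = λ _ → refl
    ; η-sym      = λ _ _ → refl
    ; η-ultra    = λ _ _ _ → z≤n
    ; η≤i        = λ _ _ → z≤n
    ; η-pos      = λ { (here refl) (here refl) x≢x → contradiction refl x≢x }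
    ; link       = λ { (here refl) (here refl) x≢x → contradiction refl x≢x }
    }

  root-thick : ∀ {e x} → e ∈ E → x ∈ˢ e → Thick (root x)
  root-thick {x = x} e∈ x∈e = record
    { top-degree = λ { (here refl) → min-degree e∈ x∈e }
    ; ∣new∣      = ≤-trans (≤-trans (s≤s z≤n) 2≤r) (≤-reflexive (sym (*-identityʳ r)))
    ; Δ-new      = ≤-trans (≤-reflexive (sym (*-identityˡ (Δ E (x ∷ []))))) (*-monoˡ-≤ _ (≤-trans (s≤s z≤n) 2≤r))
    ; Δ-old      = ≤-trans (≤-reflexive (*-zeroʳ (2 * r))) z≤n
    }

  b : ℕ
  b = 8 * (d * (r * r))

  -- The invariant `δ ^ i ≤ b ^ i * length (top tree)` is the geometric growth of the tops with
  -- denominators cleared. As `2 * b ≤ δ`, a sparse level at least doubles the top, so `n` units of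
  -- fuel suffice: a further sparse step at level `n` is impossible, since already there `2 ^ n ≤ n`
  -- would follow.
  explore : 2 * b ≤ δ → 0 < b → ∀ fuel i (tree : Tree G i) → Thick tree →
    δ ^ i ≤ b ^ i * length (top tree) → fuel + i ≡ n →
    ∃[ j ] FoundCycles G k j × δ ^ j ≤ b ^ j * n
  explore 2b≤δ 0<b fuel i tree thick le eq with Step.step tree thick
  ... | inj₁ found = i , found , ≤-trans le (*-monoʳ-≤ (b ^ i) (unique⇒length≤n (top! tree)))
  explore 2b≤δ 0<b zero i tree thick le refl | inj₂ _ = contradiction
    (*-cancelˡ-≤ (b ^ n) {{m^n≢0 b n {{ℕ.>-nonZero 0<b}}}} (begin
      b ^ n * 2 ^ n             ≡⟨ *-comm (b ^ n) (2 ^ n) ⟩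
      2 ^ n * b ^ n             ≡⟨ ^-distribʳ-* n 2 b ⟨
      (2 * b) ^ n               ≤⟨ ^-monoˡ-≤ n 2b≤δ ⟩
      δ ^ n                     ≤⟨ le ⟩
      b ^ n * length (top tree) ≤⟨ *-monoʳ-≤ (b ^ n) (unique⇒length≤n (top! tree)) ⟩
      b ^ n * n                 ∎))
    (<⇒≱ (n<2^n n))
    where open ≤-Reasoning
  explore 2b≤δ 0<b (suc fuel) i tree thick le eq | inj₂ (tree′ , thick′ , growing) =
    explore 2b≤δ 0<b fuel (suc i) tree′ thick′ (begin
      δ * δ ^ i                          ≤⟨ *-monoʳ-≤ δ le ⟩
      δ * (b ^ i * length (top tree))    ≡⟨ arith δ (b ^ i) _ ⟩
      b ^ i * (δ * length (top tree))    ≤⟨ *-monoʳ-≤ (b ^ i) growing ⟩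
      b ^ i * (b * length (top tree′))   ≡⟨ arith₂ b (b ^ i) _ ⟩
      b ^ suc i * length (top tree′)     ∎) (trans (+-suc fuel i) eq)
    where
    open ≤-Reasoning
    arith : ∀ x y z → x * (y * z) ≡ y * (x * z)
    arith = solve-∀
    arith₂ : ∀ x y z → y * (x * z) ≡ x * y * z
    arith₂ = solve-∀

-- Pruning with all vertices as labels leaves a nonempty subhypergraph whose non-isolated vertices
-- have degree at least `suc δ`; the exploration runs there, and its linear cycles are linear cycles
-- of `G`.
core : ∀ {r n} → 2 ≤ r → (G : RGraph r n) → Linear G → (k d δ : ℕ) → 4 * (suc k * r) ≤ d →
  24 * (d * (r * r * (r * r))) ≤ suc δ → n * δ < length (edges G) →
  ∃[ j ] ∃[ h ] 0 < h × h ≤ j × (∀ m → m < k → LinearCycle G (2 * h + 2 * suc m)) ×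
  suc δ ^ j ≤ (8 * (d * (r * r))) ^ j * n
core {r} {n} 2≤r G linear k d δ d-large δ-large δ-small
  with prune {R = λ x e → x ∈ˢ e} _∈?_ δ (allFin n) (edges G)
         (≤-<-trans (≤-reflexive (cong (_* δ) (length-tabulate {n = n} id))) δ-small) (unique G)
... | [] , () , _
... | e ∷ es , _ , ⊆G , distinct , min =
  let x , x∈e = some-vertex
      j , (h , 0<h , h≤j , found) , le = explore 2b≤δ 0<b n 0 (root x) (root-thick (here refl) x∈e)
        (≤-reflexive refl) (+-identityʳ n)
  in j , h , 0<h , h≤j
     , (λ m m<k → transfer (cycle⇒linearCycle {G = H} (3≤ h m 0<h) (found m m<k))) , le
  where
  H : RGraph r n
  H = record { edges = e ∷ es ; unique = distinct ; uniform = All.tabulate (All.lookup (uniform G) ∘ ⊆G) }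
  linear-H : Linear H
  linear-H e∈ f∈ = linear (⊆G e∈) (⊆G f∈)
  min-degree : ∀ {f x} → f ∈ e ∷ es → x ∈ˢ f → δ < degree (e ∷ es) x
  min-degree f∈ x∈f = min (∈-allFin _) f∈ x∈f
  open Exploration {G = H} linear-H 2≤r k d (suc δ) d-large δ-large min-degree
  transfer : ∀ {ℓ} → LinearCycle H ℓ → LinearCycle G ℓ
  transfer c = record
    { 3≤ℓ = 3≤ℓ ; edge = edge ; edge∈ = ⊆G ∘ edge∈ ; vertexCount = vertexCount
    ; consecutive = consecutive ; disjoint = disjoint }
    where open LinearCycle c
  3≤ : ∀ h m → 0 < h → 3 ≤ 2 * h + 2 * suc m
  3≤ (suc h) m _ = ≤-trans (m≤m+n 3 (suc (2 * h + 2 * m))) (≤-reflexive (arith h m))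
    where
    arith : ∀ h m → 3 + suc (2 * h + 2 * m) ≡ 2 * suc h + 2 * suc m
    arith = solve-∀
  some-vertex : ∃[ x ] x ∈ˢ e
  some-vertex with Subsetₚ.nonempty? e
  ... | yes some = some
  ... | no none  = contradiction
    (trans (sym (All.lookup (uniform H) (here refl)))
      (trans (cong ∣_∣ (Subsetₚ.Empty-unique none)) (Subsetₚ.∣⊥∣≡0 n)))
    λ { refl → case 2≤r of λ () }
  1≤r : 1 ≤ r
  1≤r = ≤-trans (s≤s z≤n) 2≤r
  2b≤δ : 2 * (8 * (d * (r * r))) ≤ suc δ
  2b≤δ = ≤-trans (begin
    2 * (8 * (d * (r * r)))          ≡⟨ *-assoc 2 8 (d * (r * r)) ⟨
    16 * (d * (r * r))               ≤⟨ *-mono-≤ {16} {24} (m≤m+n 16 8) (*-monoʳ-≤ d (begin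
      r * r                            ≡⟨ *-identityʳ (r * r) ⟨
      r * r * (1 * 1)                  ≤⟨ *-monoʳ-≤ (r * r) (*-mono-≤ 1≤r 1≤r) ⟩
      r * r * (r * r)                  ∎)) ⟩
    24 * (d * (r * r * (r * r)))     ∎) δ-large
    where open ≤-Reasoning
  0<b : 0 < 8 * (d * (r * r))
  0<b = *-mono-≤ {1} {8} (s≤s z≤n) (*-mono-≤ {1} 1≤d (*-mono-≤ 1≤r 1≤r))
    where
    1≤d : 1 ≤ d
    1≤d = ≤-trans (*-mono-≤ {1} {4} (s≤s z≤n) (*-mono-≤ {1} {suc k} (s≤s z≤n) 1≤r)) d-large

open import Data.Integer as ℤ using (ℤ; +_; -[1+_])
import Data.Integer.Properties as ℤₚ
open import Data.Integer.Tactic.RingSolver using () renaming (solve-∀ to ℤ-solve-∀)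
open import Data.Rational as ℚ using (ℚ; 0ℚ; ↥_; ↧ₙ_; _/_; toℚᵘ)
import Data.Rational.Properties as ℚₚ
open import Data.Rational.Solver using () renaming (module +-*-Solver to ℚ-Solver)
open import Data.Rational.Unnormalised as ℚᵘ using (mkℚᵘ) renaming (_≃_ to _≃ᵘ_)
import Data.Rational.Unnormalised.Properties as ℚᵘₚ

-- Fractions

ι : ℤ → ℚ
ι z = z / 1

toℚᵘ-/ : ∀ z b .{{_ : NonZero b}} → toℚᵘ (z / b) ≃ᵘ (z ℚᵘ./ b)
toℚᵘ-/ z (suc b) = ℚₚ.toℚᵘ-fromℚᵘ (mkℚᵘ z b)

ι-homo-* : ∀ a b → ι (a ℤ.* b) ≡ ι a ℚ.* ι b
ι-homo-* a b = ℚₚ.toℚᵘ-injective (ℚᵘₚ.≃-trans (toℚᵘ-/ (a ℤ.* b) 1) (ℚᵘₚ.≃-sym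
  (ℚᵘₚ.≃-trans (ℚₚ.toℚᵘ-homo-* (ι a) (ι b)) (ℚᵘₚ.*-cong (toℚᵘ-/ a 1) (toℚᵘ-/ b 1)))))

ιₙ : ℕ → ℚ
ιₙ m = ι (+ m)

ιₙ-homo-* : ∀ a b → ιₙ (a * b) ≡ ιₙ a ℚ.* ιₙ b
ιₙ-homo-* a b = trans (cong ι (ℤₚ.pos-* a b)) (ι-homo-* (+ a) (+ b))

ι-homo-+ : ∀ a b → ι (a ℤ.+ b) ≡ ι a ℚ.+ ι b
ι-homo-+ a b = ℚₚ.toℚᵘ-injective (begin
  toℚᵘ (ι (a ℤ.+ b))             ≈⟨ toℚᵘ-/ (a ℤ.+ b) 1 ⟩
  mkℚᵘ (a ℤ.+ b) 0               ≈⟨ ℚᵘ.*≡* (arith a b) ⟩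
  mkℚᵘ a 0 ℚᵘ.+ mkℚᵘ b 0         ≈⟨ ℚᵘₚ.+-cong (toℚᵘ-/ a 1) (toℚᵘ-/ b 1) ⟨
  toℚᵘ (ι a) ℚᵘ.+ toℚᵘ (ι b)     ≈⟨ ℚₚ.toℚᵘ-homo-+ (ι a) (ι b) ⟨
  toℚᵘ (ι a ℚ.+ ι b)             ∎)
  where
  open ℚᵘₚ.≃-Reasoning
  arith : ∀ a b → (a ℤ.+ b) ℤ.* + 1 ≡ (a ℤ.* + 1 ℤ.+ b ℤ.* + 1) ℤ.* + 1
  arith = ℤ-solve-∀

ιₙ-homo-+ : ∀ a b → ιₙ (a + b) ≡ ιₙ a ℚ.+ ιₙ b
ιₙ-homo-+ a b = trans (cong ι (ℤₚ.pos-+ a b)) (ι-homo-+ (+ a) (+ b))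

ιₙ-mono-< : ∀ {a b} → a < b → ιₙ a ℚ.< ιₙ b
ιₙ-mono-< {a} {b} a<b = ℚₚ.toℚᵘ-cancel-< (ℚᵘₚ.<-respˡ-≃ (ℚᵘₚ.≃-sym (toℚᵘ-/ (+ a) 1))
  (ℚᵘₚ.<-respʳ-≃ (ℚᵘₚ.≃-sym (toℚᵘ-/ (+ b) 1))
  (ℚᵘ.*<* (subst₂ ℤ._<_ (sym (ℤₚ.*-identityʳ (+ a))) (sym (ℤₚ.*-identityʳ (+ b))) (ℤ.+<+ a<b)))))

ιₙ-mono-≤ : ∀ {a b} → a ≤ b → ιₙ a ℚ.≤ ιₙ b
ιₙ-mono-≤ {a} {b} a≤b with m≤n⇒m<n∨m≡n a≤b
... | inj₁ a<b  = ℚₚ.<⇒≤ (ιₙ-mono-< a<b)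
... | inj₂ refl = ℚₚ.≤-refl

ιₙ-cancel-< : ∀ {a b} → ιₙ a ℚ.< ιₙ b → a < b
ιₙ-cancel-< {a} {b} lt = ≰⇒> λ b≤a → ℚₚ.<-irrefl refl (ℚₚ.<-≤-trans lt (ιₙ-mono-≤ b≤a))

ιₙ-cancel-≤ : ∀ {a b} → ιₙ a ℚ.≤ ιₙ b → a ≤ b
ιₙ-cancel-≤ {a} {b} le = ≮⇒≥ λ b<a → ℚₚ.<-irrefl refl (ℚₚ.<-≤-trans (ιₙ-mono-< b<a) le)

ιₙ-pos : ∀ {m} → 0 < m → ℚ.Positive (ιₙ m)
ιₙ-pos 0<m = ℚ.positive (ιₙ-mono-< 0<m)

-- Repr x s t says x = s / t, for t > 0.
record Repr (x : ℚ) (s t : ℕ) : Set where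
  constructor repr
  field
    cleared : ιₙ t ℚ.* x ≡ ιₙ s

open Repr

clear-/ : ∀ z b .{{_ : NonZero b}} → ιₙ b ℚ.* (z / b) ≡ ι z
clear-/ z b@(suc b-1) = ℚₚ.toℚᵘ-injective (begin
  toℚᵘ (ιₙ b ℚ.* (z / b))             ≈⟨ ℚₚ.toℚᵘ-homo-* (ιₙ b) (z / b) ⟩
  toℚᵘ (ιₙ b) ℚᵘ.* toℚᵘ (z / b)       ≈⟨ ℚᵘₚ.*-cong (toℚᵘ-/ (+ b) 1) (toℚᵘ-/ z b) ⟩
  mkℚᵘ (+ b) 0 ℚᵘ.* mkℚᵘ z b-1        ≈⟨ ℚᵘ.*≡* (arith (+ b) z) ⟩
  mkℚᵘ z 0                            ≈⟨ toℚᵘ-/ z 1 ⟨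
  toℚᵘ (ι z)                          ∎)
  where
  open ℚᵘₚ.≃-Reasoning
  arith : ∀ x y → (x ℤ.* y) ℤ.* + 1 ≡ y ℤ.* (+ 1 ℤ.* x)
  arith = ℤ-solve-∀

interchange : ∀ a b c d → (a ℚ.* b) ℚ.* (c ℚ.* d) ≡ (a ℚ.* c) ℚ.* (b ℚ.* d)
interchange = solve 4 (λ a b c d → (a :* b) :* (c :* d) := (a :* c) :* (b :* d)) refl
  where open ℚ-Solver

repr-* : ∀ {x y s t s′ t′} → Repr x s t → Repr y s′ t′ → Repr (x ℚ.* y) (s * s′) (t * t′)
repr-* {x} {y} {s} {t} {s′} {t′} (repr p) (repr q) = repr (begin
  ιₙ (t * t′) ℚ.* (x ℚ.* y)           ≡⟨ cong (ℚ._* (x ℚ.* y)) (ιₙ-homo-* t t′) ⟩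
  ιₙ t ℚ.* ιₙ t′ ℚ.* (x ℚ.* y)        ≡⟨ interchange (ιₙ t) (ιₙ t′) x y ⟩
  (ιₙ t ℚ.* x) ℚ.* (ιₙ t′ ℚ.* y)      ≡⟨ cong₂ ℚ._*_ p q ⟩
  ιₙ s ℚ.* ιₙ s′                      ≡⟨ ιₙ-homo-* s s′ ⟨
  ιₙ (s * s′)                         ∎)
  where open ≡-Reasoning

repr-^ : ∀ {x s t} → Repr x s t → ∀ b → Repr (x Defs.^ b) (s ^ b) (t ^ b)
repr-^ p zero    = repr refl
repr-^ p (suc b) = repr-* p (repr-^ p b)

infix 9 _⁺ _⁻
-- Writing an exponent as `z⁺ - z⁻` makes `2^ z` a fraction of natural powers, so that every
-- comparison with a logarithm becomes an inequality in `ℕ`.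
_⁺ _⁻ : ℤ → ℕ
(+ m)    ⁺ = m
-[1+ m ] ⁺ = 0
(+ m)    ⁻ = 0
-[1+ m ] ⁻ = suc m

z+z⁻≡z⁺ : ∀ z → z ℤ.+ + (z ⁻) ≡ + (z ⁺)
z+z⁻≡z⁺ (+ m)    = ℤₚ.+-identityʳ (+ m)
z+z⁻≡z⁺ -[1+ m ] = ℤₚ.+-inverseˡ (+ suc m)

repr-2^ : ∀ z → Repr (2^ z) (2 ^ z ⁺) (2 ^ z ⁻)
repr-2^ (+ m) = subst (Repr (2^ (+ m)) (2 ^ m)) (^-zeroˡ m) (repr-^ (repr refl) m)
repr-2^ -[1+ m ] = subst (λ s → Repr (2^ -[1+ m ]) s (2 ^ suc m)) (^-zeroˡ (suc m)) (repr-^ (repr refl) (suc m))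

module _ {x y s t s′ t′} (0<t : 0 < t) (0<t′ : 0 < t′) (p : Repr x s t) (q : Repr y s′ t′) where

  private
    κ = ιₙ t ℚ.* ιₙ t′

    κ-pos : ℚ.Positive κ
    κ-pos = subst ℚ.Positive (ιₙ-homo-* t t′) (ιₙ-pos (*-mono-≤ 0<t 0<t′))

    κx : κ ℚ.* x ≡ ιₙ (s * t′)
    κx = trans (shuffle (ιₙ t) (ιₙ t′) x)
      (trans (cong (ℚ._* ιₙ t′) (cleared p)) (sym (ιₙ-homo-* s t′)))
      where
      open ℚ-Solver
      shuffle : ∀ a b c → (a ℚ.* b) ℚ.* c ≡ (a ℚ.* c) ℚ.* b
      shuffle = solve 3 (λ a b c → (a :* b) :* c := (a :* c) :* b) refl

    κy : κ ℚ.* y ≡ ιₙ (s′ * t)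
    κy = trans (shuffle (ιₙ t) (ιₙ t′) y)
      (trans (cong (ℚ._* ιₙ t) (cleared q)) (sym (ιₙ-homo-* s′ t)))
      where
      open ℚ-Solver
      shuffle : ∀ a b c → (a ℚ.* b) ℚ.* c ≡ (b ℚ.* c) ℚ.* a
      shuffle = solve 3 (λ a b c → (a :* b) :* c := (b :* c) :* a) refl

  repr-<⁻ : x ℚ.< y → s * t′ < s′ * t
  repr-<⁻ x<y = ιₙ-cancel-< (subst₂ ℚ._<_ κx κy (ℚₚ.*-monoʳ-<-pos κ {{κ-pos}} x<y))

  repr-<⁺ : s * t′ < s′ * t → x ℚ.< y
  repr-<⁺ lt = ℚₚ.*-cancelˡ-<-nonNeg κ {{ℚₚ.pos⇒nonNeg κ {{κ-pos}}}}
    (subst₂ ℚ._<_ (sym κx) (sym κy) (ιₙ-mono-< lt))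

  repr-≤⁻ : x ℚ.≤ y → s * t′ ≤ s′ * t
  repr-≤⁻ x≤y = ιₙ-cancel-≤ (subst₂ ℚ._≤_ κx κy
    (ℚₚ.*-monoˡ-≤-nonNeg κ {{ℚₚ.pos⇒nonNeg κ {{κ-pos}}}} x≤y))

  repr-≤⁺ : s * t′ ≤ s′ * t → x ℚ.≤ y
  repr-≤⁺ le = ℚₚ.≮⇒≥ λ y<x → <⇒≱ (ιₙ-cancel-< (subst₂ ℚ._<_ κy κx (ℚₚ.*-monoʳ-<-pos κ {{κ-pos}} y<x))) le

-- DRepr x p q b says x = (p - q) / b, for b > 0.
record DRepr (x : ℚ) (p q b : ℕ) : Set where
  constructor dRepr
  field
    dCleared : ιₙ b ℚ.* x ℚ.+ ιₙ q ≡ ιₙ p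

open DRepr

dRepr-self : ∀ p → DRepr p ((↥ p) ⁺) ((↥ p) ⁻) (↧ₙ p)
dRepr-self p@record{} = dRepr (begin
  ιₙ (↧ₙ p) ℚ.* p ℚ.+ ιₙ ((↥ p) ⁻)               ≡⟨ cong (λ t → ιₙ (↧ₙ p) ℚ.* t ℚ.+ ιₙ ((↥ p) ⁻)) (ℚₚ.↥p/↧p≡p p) ⟨
  ιₙ (↧ₙ p) ℚ.* (↥ p / ↧ₙ p) ℚ.+ ιₙ ((↥ p) ⁻)    ≡⟨ cong (ℚ._+ ιₙ ((↥ p) ⁻)) (clear-/ (↥ p) (↧ₙ p)) ⟩
  ι (↥ p) ℚ.+ ιₙ ((↥ p) ⁻)                       ≡⟨ ι-homo-+ (↥ p) (+ ((↥ p) ⁻)) ⟨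
  ι (↥ p ℤ.+ + ((↥ p) ⁻))                        ≡⟨ cong ι (z+z⁻≡z⁺ (↥ p)) ⟩
  ιₙ ((↥ p) ⁺)                                   ∎)
  where open ≡-Reasoning

0<↧ : ∀ p → 0 < ↧ₙ p
0<↧ record{} = s≤s z≤n

ιₙ-cross : ∀ a b c d → ιₙ (a * b + c * d) ≡ ιₙ a ℚ.* ιₙ b ℚ.+ ιₙ c ℚ.* ιₙ d
ιₙ-cross a b c d = trans (ιₙ-homo-+ (a * b) (c * d)) (cong₂ ℚ._+_ (ιₙ-homo-* a b) (ιₙ-homo-* c d))

dRepr-sub : ∀ {x y p q b p′ q′ b′} → DRepr x p q b → DRepr y p′ q′ b′ →
  DRepr (x ℚ.- y) (p * b′ + q′ * b) (q * b′ + p′ * b) (b * b′)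
dRepr-sub {x} {y} {p} {q} {b} {p′} {q′} {b′} (dRepr e) (dRepr e′) = dRepr (begin
  ιₙ (b * b′) ℚ.* (x ℚ.- y) ℚ.+ ιₙ (q * b′ + p′ * b)
    ≡⟨ cong₂ (λ u v → u ℚ.* (x ℚ.- y) ℚ.+ v) (ιₙ-homo-* b b′) (ιₙ-cross q b′ p′ b) ⟩
  (B ℚ.* B′) ℚ.* (x ℚ.- y) ℚ.+ (Q ℚ.* B′ ℚ.+ ιₙ p′ ℚ.* B)
    ≡⟨ cong (λ u → (B ℚ.* B′) ℚ.* (x ℚ.- y) ℚ.+ (Q ℚ.* B′ ℚ.+ u ℚ.* B)) e′ ⟨
  (B ℚ.* B′) ℚ.* (x ℚ.- y) ℚ.+ (Q ℚ.* B′ ℚ.+ (B′ ℚ.* y ℚ.+ Q′) ℚ.* B)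
    ≡⟨ arith x y B B′ Q Q′ ⟩
  (B ℚ.* x ℚ.+ Q) ℚ.* B′ ℚ.+ Q′ ℚ.* B
    ≡⟨ cong (λ u → u ℚ.* B′ ℚ.+ Q′ ℚ.* B) e ⟩
  ιₙ p ℚ.* B′ ℚ.+ Q′ ℚ.* B
    ≡⟨ ιₙ-cross p b′ q′ b ⟨
  ιₙ (p * b′ + q′ * b) ∎)
  where
  open ≡-Reasoning
  open ℚ-Solver
  B = ιₙ b ; B′ = ιₙ b′ ; Q = ιₙ q ; Q′ = ιₙ q′
  arith : ∀ x y B B′ Q Q′ →
    (B ℚ.* B′) ℚ.* (x ℚ.- y) ℚ.+ (Q ℚ.* B′ ℚ.+ (B′ ℚ.* y ℚ.+ Q′) ℚ.* B) ≡
    (B ℚ.* x ℚ.+ Q) ℚ.* B′ ℚ.+ Q′ ℚ.* B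
  arith = solve 6 (λ x y B B′ Q Q′ →
    (B :* B′) :* (x :- y) :+ (Q :* B′ :+ (B′ :* y :+ Q′) :* B) :=
    (B :* x :+ Q) :* B′ :+ Q′ :* B) refl

dRepr-scale : ∀ {x p q b} m → DRepr x p q b → DRepr (ιₙ m ℚ.* x) (m * p) (m * q) b
dRepr-scale {x} {p} {q} {b} m (dRepr e) = dRepr (begin
  ιₙ b ℚ.* (ιₙ m ℚ.* x) ℚ.+ ιₙ (m * q)         ≡⟨ cong (ιₙ b ℚ.* (ιₙ m ℚ.* x) ℚ.+_) (ιₙ-homo-* m q) ⟩
  ιₙ b ℚ.* (ιₙ m ℚ.* x) ℚ.+ ιₙ m ℚ.* ιₙ q      ≡⟨ arith (ιₙ b) (ιₙ m) x (ιₙ q) ⟩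
  ιₙ m ℚ.* (ιₙ b ℚ.* x ℚ.+ ιₙ q)               ≡⟨ cong (ιₙ m ℚ.*_) e ⟩
  ιₙ m ℚ.* ιₙ p                                ≡⟨ ιₙ-homo-* m p ⟨
  ιₙ (m * p)                                   ∎)
  where
  open ≡-Reasoning
  open ℚ-Solver
  arith : ∀ b m x q → b ℚ.* (m ℚ.* x) ℚ.+ m ℚ.* q ≡ m ℚ.* (b ℚ.* x ℚ.+ q)
  arith = solve 4 (λ b m x q → b :* (m :* x) :+ m :* q := m :* (b :* x :+ q)) refl

module _ {x y p q b p′ q′ b′} (e : DRepr x p q b) (e′ : DRepr y p′ q′ b′) where

  private
    Z = ιₙ q ℚ.* ιₙ b′ ℚ.+ ιₙ q′ ℚ.* ιₙ b

    lhs : (ιₙ b ℚ.* ιₙ b′) ℚ.* x ℚ.+ Z ≡ ιₙ (p * b′ + q′ * b)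
    lhs = trans (arith x (ιₙ b) (ιₙ b′) (ιₙ q) (ιₙ q′))
      (trans (cong (λ u → u ℚ.* ιₙ b′ ℚ.+ ιₙ q′ ℚ.* ιₙ b) (dCleared e)) (sym (ιₙ-cross p b′ q′ b)))
      where
      open ℚ-Solver
      arith : ∀ x b b′ q q′ → (b ℚ.* b′) ℚ.* x ℚ.+ (q ℚ.* b′ ℚ.+ q′ ℚ.* b) ≡ (b ℚ.* x ℚ.+ q) ℚ.* b′ ℚ.+ q′ ℚ.* b
      arith = solve 5 (λ x b b′ q q′ →
        (b :* b′) :* x :+ (q :* b′ :+ q′ :* b) := (b :* x :+ q) :* b′ :+ q′ :* b) refl

    rhs : (ιₙ b ℚ.* ιₙ b′) ℚ.* y ℚ.+ Z ≡ ιₙ (p′ * b + q * b′)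
    rhs = trans (arith y (ιₙ b) (ιₙ b′) (ιₙ q) (ιₙ q′))
      (trans (cong (λ u → u ℚ.* ιₙ b ℚ.+ ιₙ q ℚ.* ιₙ b′) (dCleared e′)) (sym (ιₙ-cross p′ b q b′)))
      where
      open ℚ-Solver
      arith : ∀ x b b′ q q′ → (b ℚ.* b′) ℚ.* x ℚ.+ (q ℚ.* b′ ℚ.+ q′ ℚ.* b) ≡ (b′ ℚ.* x ℚ.+ q′) ℚ.* b ℚ.+ q ℚ.* b′
      arith = solve 5 (λ x b b′ q q′ →
        (b :* b′) :* x :+ (q :* b′ :+ q′ :* b) := (b′ :* x :+ q′) :* b :+ q :* b′) refl

  -- Both sides are multiplied by `b * b′`, and `q * b′ + q′ * b` is added to remove the
  -- subtractions.
  dRepr-≤ : x ℚ.≤ y → p * b′ + q′ * b ≤ p′ * b + q * b′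
  dRepr-≤ x≤y = ιₙ-cancel-≤ (subst₂ ℚ._≤_ lhs rhs (ℚₚ.+-monoˡ-≤ Z
    (subst (λ κ → κ ℚ.* x ℚ.≤ κ ℚ.* y) (ιₙ-homo-* b b′)
      (ℚₚ.*-monoˡ-≤-nonNeg (ιₙ (b * b′)) {{ℚ.nonNegative (ιₙ-mono-≤ {0} {b * b′} z≤n)}} x≤y))))

dRepr-≡ : ∀ {x p q b p′ q′ b′} → DRepr x p q b → DRepr x p′ q′ b′ → p * b′ + q′ * b ≡ p′ * b + q * b′
dRepr-≡ e e′ = ≤-antisym (dRepr-≤ e e′ ℚₚ.≤-refl) (dRepr-≤ e′ e ℚₚ.≤-refl)

-- Powers and logarithms

crossing : {P : ℕ → Set} → (∀ m → Dec (P m)) → ¬ P 0 → ∀ m → P m → ∃[ a ] ¬ P a × P (suc a)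
crossing P? ¬P0 zero    P0 = contradiction P0 ¬P0
crossing P? ¬P0 (suc m) Pm with P? m
... | no ¬p = m , ¬p , Pm
... | yes p = crossing P? ¬P0 m p

-- Bernoulli's inequality `(1 + 1 / y) ^ m ≥ 1 + m / y`, multiplied by `y ^ suc m`.
bernoulli : ∀ y m → y ^ m * (y + m) ≤ y * suc y ^ m
bernoulli y zero    = ≤-reflexive (trans (*-identityˡ (y + 0)) (trans (+-identityʳ y) (sym (*-identityʳ y))))
bernoulli y (suc m) = begin
  y * y ^ m * (y + suc m)                  ≤⟨ m≤m+n _ (y ^ m * m) ⟩
  y * y ^ m * (y + suc m) + y ^ m * m      ≡⟨ arith y m (y ^ m) ⟩
  suc y * (y ^ m * (y + m))                ≤⟨ *-monoʳ-≤ (suc y) (bernoulli y m) ⟩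
  suc y * (y * suc y ^ m)                  ≡⟨ arith′ y (suc y) (suc y ^ m) ⟩
  y * (suc y * suc y ^ m)                  ∎
  where
  open ≤-Reasoning
  arith : ∀ y m p → y * p * (y + suc m) + p * m ≡ suc y * (p * (y + m))
  arith = solve-∀
  arith′ : ∀ y a p → a * (y * p) ≡ y * (a * p)
  arith′ = solve-∀

double : ∀ {x y} → 0 < y → y < x → 2 * y ^ y ≤ x ^ y
double {x} {y} 0<y y<x = ≤-trans (*-cancelˡ-≤ y {{ℕ.>-nonZero 0<y}} (begin
  y * (2 * y ^ y)     ≡⟨ arith y (y ^ y) ⟩
  y ^ y * (y + y)     ≤⟨ bernoulli y y ⟩
  y * suc y ^ y       ∎)) (^-monoˡ-≤ y y<x)
  where
  open ≤-Reasoning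
  arith : ∀ y p → y * (2 * p) ≡ p * (y + y)
  arith = solve-∀

-- Turns a strict inequality between integers into a gap of any prescribed number of binary digits,
-- at an explicit exponent.
power-gap : ∀ {x y} → 0 < y → y < x → ∀ c → 2 ^ c * y ^ (y * c) ≤ x ^ (y * c)
power-gap {x} {y} 0<y y<x c = begin
  2 ^ c * y ^ (y * c)      ≡⟨ cong (2 ^ c *_) (^-*-assoc y y c) ⟨
  2 ^ c * (y ^ y) ^ c      ≡⟨ ^-distribʳ-* c 2 (y ^ y) ⟨
  (2 * y ^ y) ^ c          ≤⟨ ^-monoˡ-≤ c (double 0<y y<x) ⟩
  (x ^ y) ^ c              ≡⟨ ^-*-assoc x y c ⟩
  x ^ (y * c)              ∎
  where open ≤-Reasoning

^-pos : ∀ {x} m → 0 < x → 0 < x ^ m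
^-pos {suc x} m _ = m^n>0 (suc x) m

^-swap : ∀ x a b → (x ^ a) ^ b ≡ (x ^ b) ^ a
^-swap x a b = trans (^-*-assoc x a b) (trans (cong (x ^_) (*-comm a b)) (sym (^-*-assoc x b a)))

2^-cancel-< : ∀ {a b} → 2 ^ a < 2 ^ b → a < b
2^-cancel-< lt = ≰⇒> λ b≤a → <⇒≱ lt (^-monoʳ-≤ 2 b≤a)

⌊log⌋ : ∀ x y → 0 < y → y ≤ x → ∃[ a ] 2 ^ a * y ≤ x × x < 2 ^ suc a * y
⌊log⌋ x y 0<y y≤x with crossing (λ a → x <? 2 ^ a * y) (λ lt → <⇒≱ lt (≤-trans (≤-reflexive (*-identityˡ y)) y≤x))
    x (<-≤-trans (n<2^n x) (≤-trans (≤-reflexive (sym (*-identityʳ (2 ^ x)))) (*-monoʳ-≤ (2 ^ x) 0<y)))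
... | a , ≮ , lt = a , ≮⇒≥ ≮ , lt

-- Above p q b s t says (p - q) / b < log₂ (s / t), for b, s, t > 0.
Above : (p q b s t : ℕ) → Set
Above p q b s t = 2 ^ p * t ^ b < s ^ b * 2 ^ q

^-*-^ : ∀ x y a b c → (x ^ a * y ^ b) ^ c ≡ x ^ (a * c) * y ^ (b * c)
^-*-^ x y a b c = trans (^-distribʳ-* c (x ^ a) (y ^ b)) (cong₂ _*_ (^-*-assoc x a c) (^-*-assoc y b c))

above-raise : ∀ p q b s t c → 0 < c → Above p q b s t → Above (p * c) (q * c) (b * c) s t
above-raise p q b s t c@(suc _) _ lt = subst₂ _<_ (^-*-^ 2 t p b c) (^-*-^ s 2 b q c) (^-monoˡ-< c lt)

above-* : ∀ {p q b s t p′ q′ b′ s′ t′} → 0 < b → 0 < b′ → Above p q b s t → Above p′ q′ b′ s′ t′ →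
  Above (p * b′ + p′ * b) (q * b′ + q′ * b) (b * b′) (s * s′) (t * t′)
above-* {p} {q} {b} {s} {t} {p′} {q′} {b′} {s′} {t′} 0<b 0<b′ lt lt′ = subst₂ _<_
  (trans (arith (2 ^ (p * b′)) (t ^ (b * b′)) (2 ^ (p′ * b)) (t′ ^ (b′ * b))) (cong₂ _*_
    (sym (^-distribˡ-+-* 2 (p * b′) (p′ * b)))
    (trans (cong (λ e → t ^ (b * b′) * t′ ^ e) (*-comm b′ b)) (sym (^-distribʳ-* (b * b′) t t′)))))
  (trans (arith (s ^ (b * b′)) (2 ^ (q * b′)) (s′ ^ (b′ * b)) (2 ^ (q′ * b))) (cong₂ _*_
    (trans (cong (λ e → s ^ (b * b′) * s′ ^ e) (*-comm b′ b)) (sym (^-distribʳ-* (b * b′) s s′)))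
    (sym (^-distribˡ-+-* 2 (q * b′) (q′ * b)))))
  (*-mono-< (above-raise p q b s t b′ 0<b′ lt) (above-raise p′ q′ b′ s′ t′ b 0<b lt′))
  where
  arith : ∀ a b c d → a * b * (c * d) ≡ a * c * (b * d)
  arith = solve-∀

above-^ : ∀ {p q b s t} m → 0 < m → Above p q b s t → Above (m * p) (m * q) b (s ^ m) (t ^ m)
above-^ {p} {q} {b} {s} {t} m 0<m lt = subst₂ _<_
  (cong₂ _*_ (cong (2 ^_) (*-comm p m)) (trans (sym (^-*-assoc t b m)) (^-swap t b m)))
  (cong₂ _*_ (trans (sym (^-*-assoc s b m)) (^-swap s b m)) (cong (2 ^_) (*-comm q m)))
  (above-raise p q b s t m 0<m lt)

above⇒< : ∀ {p q b s t} → Above p q b s t → q ≤ p → t < s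
above⇒< {p} {q} {b} {s} {t} lt q≤p = ≰⇒> λ s≤t → <⇒≱ lt (begin
  s ^ b * 2 ^ q    ≤⟨ *-mono-≤ (^-monoˡ-≤ b s≤t) (^-monoʳ-≤ 2 q≤p) ⟩
  t ^ b * 2 ^ p    ≡⟨ *-comm (t ^ b) (2 ^ p) ⟩
  2 ^ p * t ^ b    ∎)
  where open ≤-Reasoning

above-swap : ∀ p q b s t → s ^ b * 2 ^ q < 2 ^ p * t ^ b → Above q p b t s
above-swap p q b s t = subst₂ _<_ (*-comm (s ^ b) (2 ^ q)) (*-comm (2 ^ p) (t ^ b))

-- Needed because `+ a / b` is normalised, so its numerator and denominator may differ from `a` and
-- `b`. If the claim failed, raising the two inequalities to the powers `B` and `b` and multiplying
-- them would make a number smaller than itself.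
above-cong : ∀ {p q b P Q B s t} → 0 < s → 0 < B → p * B + Q * b ≡ P * b + q * B →
             Above p q b s t → Above P Q B s t
above-cong {p} {q} {b} {P} {Q} {B} {s} {t} 0<s 0<B eq lt = ≰⇒> λ le → <-irrefl both
  (<-≤-trans (*-monoˡ-< (S * 2 ^ (Q * b)) {{ℕ.>-nonZero (*-mono-≤ (^-pos (b * B) 0<s) (m^n>0 2 (Q * b)))}}
    (above-raise p q b s t B 0<B lt))
    (*-monoʳ-≤ (S * 2 ^ (q * B)) (subst₂ _≤_
      (trans (^-*-^ s 2 B Q b) (cong (λ e → s ^ e * 2 ^ (Q * b)) (*-comm B b)))
      (trans (^-*-^ 2 t P B b) (cong (λ e → 2 ^ (P * b) * t ^ e) (*-comm B b)))
      (^-monoˡ-≤ b le))))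
  where
  S = s ^ (b * B)
  T = t ^ (b * B)
  arith₁ : ∀ a b c d → a * b * (c * d) ≡ (c * b) * (a * d)
  arith₁ = solve-∀
  arith₂ : ∀ a b c d → a * b * (c * d) ≡ (a * d) * (c * b)
  arith₂ = solve-∀
  both : 2 ^ (p * B) * T * (S * 2 ^ (Q * b)) ≡ S * 2 ^ (q * B) * (2 ^ (P * b) * T)
  both = begin
    2 ^ (p * B) * T * (S * 2 ^ (Q * b))    ≡⟨ arith₁ (2 ^ (p * B)) T S (2 ^ (Q * b)) ⟩
    S * T * (2 ^ (p * B) * 2 ^ (Q * b))    ≡⟨ cong (S * T *_) (^-distribˡ-+-* 2 (p * B) (Q * b)) ⟨
    S * T * 2 ^ (p * B + Q * b)            ≡⟨ cong (λ e → S * T * 2 ^ e) eq ⟩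
    S * T * 2 ^ (P * b + q * B)            ≡⟨ cong (S * T *_) (^-distribˡ-+-* 2 (P * b) (q * B)) ⟩
    S * T * (2 ^ (P * b) * 2 ^ (q * B))    ≡⟨ arith₂ S (2 ^ (q * B)) (2 ^ (P * b)) T ⟨
    S * 2 ^ (q * B) * (2 ^ (P * b) * T)    ∎
    where open ≡-Reasoning

dRepr-/ : ∀ a b .{{_ : NonZero b}} → DRepr (+ a / b) a 0 b
dRepr-/ a b = dRepr (trans (ℚₚ.+-identityʳ _) (clear-/ (+ a) b))

module _ {x s t} (0<s : 0 < s) (0<t : 0 < t) (rep : Repr x s t) where

  lower⁻ : ∀ u → Lower (log₂ x) u → Above ((↥ u) ⁺) ((↥ u) ⁻) (↧ₙ u) s t
  lower⁻ u = repr-<⁻ (m^n>0 2 ((↥ u) ⁻)) (^-pos (↧ₙ u) 0<t) (repr-2^ (↥ u)) (repr-^ rep (↧ₙ u))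

  -- An upper bound on a logarithm is the negative of a lower bound on the logarithm of the inverse,
  -- so `Above` with `s` and `t` exchanged covers it.
  upper⁻ : ∀ u → Upper (log₂ x) u → Above ((↥ u) ⁻) ((↥ u) ⁺) (↧ₙ u) t s
  upper⁻ u lt = above-swap ((↥ u) ⁺) ((↥ u) ⁻) (↧ₙ u) s t
    (repr-<⁻ (^-pos (↧ₙ u) 0<t) (m^n>0 2 ((↥ u) ⁻)) (repr-^ rep (↧ₙ u)) (repr-2^ (↥ u)) lt)

  module _ (a b : ℕ) .{{b≢0 : NonZero b}} where

    private
      p = + a / b

      same : a * ↧ₙ p + (↥ p) ⁻ * b ≡ (↥ p) ⁺ * b + 0 * ↧ₙ p
      same = dRepr-≡ (dRepr-/ a b) (dRepr-self p)

    lower⁺ : 2 ^ a * t ^ b < s ^ b → Lower (log₂ x) p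
    lower⁺ lt = repr-<⁺ (m^n>0 2 ((↥ p) ⁻)) (^-pos (↧ₙ p) 0<t) (repr-2^ (↥ p)) (repr-^ rep (↧ₙ p))
      (above-cong {a} {0} {b} {(↥ p) ⁺} {(↥ p) ⁻} {↧ₙ p} 0<s (0<↧ p) same
        (subst (2 ^ a * t ^ b <_) (sym (*-identityʳ (s ^ b))) lt))

    upper⁺ : s ^ b < 2 ^ a * t ^ b → Upper (log₂ x) p
    upper⁺ lt = repr-<⁺ (^-pos (↧ₙ p) 0<t) (m^n>0 2 ((↥ p) ⁻)) (repr-^ rep (↧ₙ p)) (repr-2^ (↥ p))
      (subst₂ _<_ (*-comm (2 ^ (↥ p) ⁻) (s ^ ↧ₙ p)) (*-comm (t ^ ↧ₙ p) (2 ^ (↥ p) ⁺))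
        (above-cong {0} {a} {b} {(↥ p) ⁻} {(↥ p) ⁺} {↧ₙ p} 0<t (0<↧ p)
          (trans (+-comm (0 * ↧ₙ p) ((↥ p) ⁺ * b)) (trans (sym same) (+-comm (a * ↧ₙ p) ((↥ p) ⁻ * b))))
          (subst₂ _<_ (sym (*-identityˡ (s ^ b))) (*-comm (2 ^ a) (t ^ b)) lt)))

repr-/ : ∀ a b .{{_ : NonZero b}} → Repr (+ a / b) a b
repr-/ a b = repr (clear-/ (+ a) b)

repr-sub : ∀ {x y p q b} → Repr x (p + q) b → Repr y q b → Repr (x ℚ.- y) p b
repr-sub {x} {y} {p} {q} {b} (repr e) (repr f) = repr (begin
  ιₙ b ℚ.* (x ℚ.- y)              ≡⟨ expand (ιₙ b) x y ⟩
  ιₙ b ℚ.* x ℚ.- ιₙ b ℚ.* y       ≡⟨ cong₂ ℚ._-_ (trans e (ιₙ-homo-+ p q)) f ⟩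
  (ιₙ p ℚ.+ ιₙ q) ℚ.- ιₙ q        ≡⟨ cancel (ιₙ p) (ιₙ q) ⟩
  ιₙ p                            ∎)
  where
  open ≡-Reasoning
  open ℚ-Solver
  expand : ∀ b x y → b ℚ.* (x ℚ.- y) ≡ b ℚ.* x ℚ.- b ℚ.* y
  expand = solve 3 (λ b x y → b :* (x :- y) := b :* x :- b :* y) refl
  cancel : ∀ p q → (p ℚ.+ q) ℚ.- q ≡ p
  cancel = solve 2 (λ p q → (p :+ q) :- q := p) refl

0≤p-q⇒q≤p : ∀ {p q} → 0ℚ ℚ.≤ p ℚ.- q → q ℚ.≤ p
0≤p-q⇒q≤p {p} {q} le = subst₂ ℚ._≤_ (ℚₚ.+-identityˡ q) (cancel p q) (ℚₚ.+-monoˡ-≤ q le)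
  where
  open ℚ-Solver
  cancel : ∀ p q → (p ℚ.- q) ℚ.+ q ≡ p
  cancel = solve 2 (λ p q → (p :- q) :+ q := p) refl

-- The quotient of logarithms and its ceiling

module LogQuotient {x s t c N} (0<s : 0 < s) (0<t : 0 < t) (rep : Repr x s t) (2≤c : 2 ≤ c) (2≤N : 2 ≤ N) where

  private
    D Q : ℝ
    D = log₂ x -ᴿ log₂ (ιₙ c)
    Q = log₂ (ιₙ N) /ᴿ D

    0<c : 0 < c
    0<c = ≤-trans (s≤s z≤n) 2≤c

    0<N : 0 < N
    0<N = ≤-trans (s≤s z≤n) 2≤N

    repr-ι : ∀ m → Repr (ιₙ m) m 1
    repr-ι m = repr-/ m 1

  -- Adding `log₂ (s / t) > u` and `log₂ (1 / c) > - v`, where `u ≥ v`, gives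
  -- `log₂ (s / (t * c)) > 0`.
  positive⇒< : Positive D → c * t < s
  positive⇒< (u , v , Lu , Uv , 0≤u-v) = subst₂ _<_ (*-comm t c) (*-identityʳ s)
    (above⇒< {b = ↧ₙ u * ↧ₙ v} (above-* {(↥ u) ⁺} {(↥ u) ⁻} {↧ₙ u} {s} {t} {(↥ v) ⁻} {(↥ v) ⁺} {↧ₙ v} {1} {c}
       (0<↧ u) (0<↧ v) (lower⁻ 0<s 0<t rep u Lu) (upper⁻ 0<c (s≤s z≤n) (repr-ι c) v Uv))
      (≤-trans (≤-reflexive (+-comm ((↥ u) ⁻ * ↧ₙ v) ((↥ v) ⁺ * ↧ₙ u)))
        (dRepr-≤ (dRepr-self v) (dRepr-self u) (0≤p-q⇒q≤p 0≤u-v))))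

  -- A lower bound `m` would come with `u < log₂ N` and `w` above the denominator such that
  -- `m * w ≤ u`; adding the bounds gives `log₂ (N * (t * c) ^ m / s ^ m) > 0`, against the
  -- hypothesis.
  ¬lower : ∀ m → 0 < m → N * (c * t) ^ m ≤ s ^ m → ¬ Lower Q (ιₙ m)
  ¬lower m 0<m le (u , v , w , Lu , _ , _ , (u₁ , v₁ , Uu₁ , Lv₁ , u₁-v₁≤w) , _ , mw≤u) =
    <⇒≱ (above⇒< {b = ↧ₙ u₁ * ↧ₙ v₁ * ↧ₙ u} above exponents) (begin
      (t * c) ^ m * N     ≡⟨ *-comm ((t * c) ^ m) N ⟩
      N * (t * c) ^ m     ≡⟨ cong (λ y → N * y ^ m) (*-comm t c) ⟩
      N * (c * t) ^ m     ≤⟨ le ⟩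
      s ^ m               ≡⟨ cong (_^ m) (*-identityʳ s) ⟨
      (s * 1) ^ m         ≡⟨ *-identityʳ ((s * 1) ^ m) ⟨
      (s * 1) ^ m * 1     ∎)
    where
    open ≤-Reasoning
    b = ↧ₙ u₁ * ↧ₙ v₁
    P′ = (↥ u₁) ⁺ * ↧ₙ v₁ + (↥ v₁) ⁻ * ↧ₙ u₁
    Q′ = (↥ u₁) ⁻ * ↧ₙ v₁ + (↥ v₁) ⁺ * ↧ₙ u₁
    above₁ : Above Q′ P′ b (t * c) (s * 1)
    above₁ = above-* {(↥ u₁) ⁻} {(↥ u₁) ⁺} {↧ₙ u₁} {t} {s} {(↥ v₁) ⁺} {(↥ v₁) ⁻} {↧ₙ v₁} {c} {1}
      (0<↧ u₁) (0<↧ v₁) (upper⁻ 0<s 0<t rep u₁ Uu₁) (lower⁻ 0<c (s≤s z≤n) (repr-ι c) v₁ Lv₁)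
    above : Above (m * Q′ * ↧ₙ u + (↥ u) ⁺ * b) (m * P′ * ↧ₙ u + (↥ u) ⁻ * b) (b * ↧ₙ u)
                  ((t * c) ^ m * N) ((s * 1) ^ m * 1)
    above = above-* {m * Q′} {m * P′} {b} {(t * c) ^ m} {(s * 1) ^ m} {(↥ u) ⁺} {(↥ u) ⁻} {↧ₙ u} {N} {1}
      (*-mono-≤ (0<↧ u₁) (0<↧ v₁)) (0<↧ u)
      (above-^ {Q′} {P′} {b} {t * c} {s * 1} m 0<m above₁)
      (lower⁻ 0<N (s≤s z≤n) (repr-ι N) u Lu)
    exponents : m * P′ * ↧ₙ u + (↥ u) ⁻ * b ≤ m * Q′ * ↧ₙ u + (↥ u) ⁺ * b
    exponents = ≤-trans
      (dRepr-≤ (dRepr-scale m (dRepr-sub (dRepr-self u₁) (dRepr-self v₁))) (dRepr-self u)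
        (ℚₚ.≤-trans (ℚₚ.*-monoˡ-≤-nonNeg (ιₙ m) {{ℚ.nonNegative (ιₙ-mono-≤ {0} {m} z≤n)}} u₁-v₁≤w) mw≤u))
      (≤-reflexive (+-comm ((↥ u) ⁺ * b) (m * Q′ * ↧ₙ u)))

  -- With a sufficiently large common denominator b, the floors 1 + aN, 1 + aC and
  -- 6 + aC + z of b log₂ N, b log₂ c and b log₂ (s / t) are sharp enough bounds.
  record Approximation (m : ℕ) : Set where
    field
      b aN aC z : ℕ
      0<b       : 0 < b
      N-lower   : 2 ^ suc aN ≤ N ^ b
      c-lower   : 2 ^ suc aC ≤ c ^ b
      c-upper   : c ^ b < 2 ^ (2 + aC)
      x-lower   : 2 ^ (6 + aC + z) * t ^ b ≤ s ^ b
      x-upper   : s ^ b < 2 ^ (7 + aC + z) * t ^ b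
      room      : m * (7 + z) ≤ aN

  -- The exponent `b` is a multiple of both `c * t` and `s ^ m`, so `power-gap` applies to each of
  -- the two strict hypotheses and yields `K = 5 + 3 * m` spare digits. The 5 secures the form
  -- `6 + aC + z` of the floor `aq`; the `3 * m` raises the factor `4 + z`, which is `aq` less
  -- `2 + aC`, to the `7 + z` of `room`.
  approximation : c * t < s → ∀ m → s ^ m < N * (c * t) ^ m → Approximation m
  approximation ct<s m lt
    with ⌊log⌋ (s ^ b) (t ^ b) (^-pos b 0<t) (^-monoˡ-≤ b t≤s)
       | ⌊log⌋ (c ^ b) 1 (s≤s z≤n) (^-pos b 0<c)
       | ⌊log⌋ (N ^ b) 1 (s≤s z≤n) (^-pos b 0<N)
    where
    y₁ = c * t
    y₂ = s ^ m
    K  = 5 + 3 * m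
    b  = y₁ * (y₂ * K)
    t≤s : t ≤ s
    t≤s = ≤-trans (≤-trans (≤-reflexive (sym (*-identityˡ t))) (*-monoˡ-≤ t 0<c)) (<⇒≤ ct<s)
  -- The floor of `b * log₂ c` is positive because `c ≥ 2` and `b > 0`.
  ... | aq , x-lower , x-upper | zero , _ , c-upper | _ =
    contradiction (≤-trans 2≤c (≤-trans (≤-reflexive (sym (^-identityʳ c))) (^-monoʳ-≤ c {{ℕ.>-nonZero 0<c}} 0<b)))
      (<⇒≱ c-upper)
    where
    0<b : 0 < c * t * (s ^ m * (5 + 3 * m))
    0<b = *-mono-≤ (*-mono-≤ 0<c 0<t) (*-mono-≤ (^-pos m 0<s) (s≤s z≤n))
  ... | aq , x-lower , x-upper | suc aC , c-lower , c-upper | aN , N-lower , N-upper = result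
    where
    open ≤-Reasoning
    y₁ = c * t
    y₂ = s ^ m
    K  = 5 + 3 * m
    b  = y₁ * (y₂ * K)
    T  = t ^ b
    0<y₁ : 0 < y₁
    0<y₁ = *-mono-≤ 0<c 0<t
    0<y₂ : 0 < y₂
    0<y₂ = ^-pos m 0<s
    0<T : 0 < T
    0<T = ^-pos b 0<t

    gap₁ : 2 ^ K * y₁ ^ b ≤ s ^ b
    gap₁ = ≤-trans (*-monoˡ-≤ (y₁ ^ b) (^-monoʳ-≤ 2 (≤-trans (≤-reflexive (sym (*-identityˡ K))) (*-monoˡ-≤ K 0<y₂))))
      (power-gap 0<y₁ ct<s (y₂ * K))

    gap₂ : 2 ^ K * y₂ ^ b ≤ (N * y₁ ^ m) ^ b
    gap₂ = ≤-trans (*-monoˡ-≤ (y₂ ^ b) (^-monoʳ-≤ 2 (≤-trans (≤-reflexive (sym (*-identityˡ K))) (*-monoˡ-≤ K 0<y₁))))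
      (subst (λ e → 2 ^ (y₁ * K) * y₂ ^ e ≤ (N * y₁ ^ m) ^ e) (arith y₁ y₂ K) (power-gap 0<y₂ lt (y₁ * K)))
      where
      arith : ∀ y₁ y₂ K → y₂ * (y₁ * K) ≡ y₁ * (y₂ * K)
      arith = solve-∀

    aC-aq : K + suc aC ≤ aq
    aC-aq = ℕ.s≤s⁻¹ (2^-cancel-< (*-cancelʳ-< T _ _ (begin-strict
      2 ^ (K + suc aC) * T            ≡⟨ cong (_* T) (^-distribˡ-+-* 2 K (suc aC)) ⟩
      2 ^ K * 2 ^ suc aC * T          ≡⟨ *-assoc (2 ^ K) (2 ^ suc aC) T ⟩
      2 ^ K * (2 ^ suc aC * T)        ≤⟨ *-monoʳ-≤ (2 ^ K) (*-monoˡ-≤ T (≤-trans (≤-reflexive (sym (*-identityʳ (2 ^ suc aC)))) c-lower)) ⟩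
      2 ^ K * (c ^ b * T)             ≡⟨ cong (2 ^ K *_) (^-distribʳ-* b c t) ⟨
      2 ^ K * y₁ ^ b                  ≤⟨ gap₁ ⟩
      s ^ b                           <⟨ x-upper ⟩
      2 ^ suc aq * T                  ∎)))

    o = aq ∸ (K + suc aC)
    z = 3 * m + o

    aq≡ : aq ≡ 6 + aC + z
    aq≡ = trans (sym (m+[n∸m]≡n aC-aq)) (arith m aC o)
      where
      arith : ∀ m aC o → 5 + 3 * m + suc aC + o ≡ 6 + aC + (3 * m + o)
      arith = solve-∀

    aN-bound : K + aq * m < suc aN + (2 + aC) * m
    aN-bound = 2^-cancel-< (*-cancelʳ-< (T ^ m) _ _ (begin-strict
      2 ^ (K + aq * m) * T ^ m            ≡⟨ cong (_* T ^ m) (^-distribˡ-+-* 2 K (aq * m)) ⟩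
      2 ^ K * 2 ^ (aq * m) * T ^ m        ≡⟨ *-assoc (2 ^ K) (2 ^ (aq * m)) (T ^ m) ⟩
      2 ^ K * (2 ^ (aq * m) * T ^ m)      ≡⟨ cong (λ e → 2 ^ K * (e * T ^ m)) (^-*-assoc 2 aq m) ⟨
      2 ^ K * ((2 ^ aq) ^ m * T ^ m)      ≡⟨ cong (2 ^ K *_) (^-distribʳ-* m (2 ^ aq) T) ⟨
      2 ^ K * (2 ^ aq * T) ^ m            ≤⟨ *-monoʳ-≤ (2 ^ K) (^-monoˡ-≤ m x-lower) ⟩
      2 ^ K * (s ^ b) ^ m                 ≡⟨ cong (2 ^ K *_) (^-swap s b m) ⟩
      2 ^ K * y₂ ^ b                      ≤⟨ gap₂ ⟩
      (N * y₁ ^ m) ^ b                    ≡⟨ ^-distribʳ-* b N (y₁ ^ m) ⟩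
      N ^ b * (y₁ ^ m) ^ b                ≡⟨ cong (N ^ b *_) (^-swap y₁ m b) ⟩
      N ^ b * (y₁ ^ b) ^ m                ≡⟨ cong (λ e → N ^ b * e ^ m) (^-distribʳ-* b c t) ⟩
      N ^ b * (c ^ b * T) ^ m             ≤⟨ *-monoʳ-≤ (N ^ b) (^-monoˡ-≤ m (*-monoˡ-≤ T (<⇒≤ c-upper′))) ⟩
      N ^ b * (2 ^ (2 + aC) * T) ^ m      <⟨ *-monoˡ-< _ {{ℕ.>-nonZero (^-pos m (*-mono-≤ (m^n>0 2 (2 + aC)) 0<T))}} N-upper′ ⟩
      2 ^ suc aN * (2 ^ (2 + aC) * T) ^ m ≡⟨ cong (2 ^ suc aN *_) (^-distribʳ-* m (2 ^ (2 + aC)) T) ⟩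
      2 ^ suc aN * ((2 ^ (2 + aC)) ^ m * T ^ m) ≡⟨ cong (λ e → 2 ^ suc aN * (e * T ^ m)) (^-*-assoc 2 (2 + aC) m) ⟩
      2 ^ suc aN * (2 ^ ((2 + aC) * m) * T ^ m) ≡⟨ *-assoc (2 ^ suc aN) (2 ^ ((2 + aC) * m)) (T ^ m) ⟨
      2 ^ suc aN * 2 ^ ((2 + aC) * m) * T ^ m   ≡⟨ cong (_* T ^ m) (^-distribˡ-+-* 2 (suc aN) ((2 + aC) * m)) ⟨
      2 ^ (suc aN + (2 + aC) * m) * T ^ m ∎))
      where
      c-upper′ : c ^ b < 2 ^ (2 + aC)
      c-upper′ = <-≤-trans c-upper (≤-reflexive (*-identityʳ (2 ^ (2 + aC))))
      N-upper′ : N ^ b < 2 ^ suc aN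
      N-upper′ = <-≤-trans N-upper (≤-reflexive (*-identityʳ (2 ^ suc aN)))

    room : 5 + m * (7 + z) ≤ aN
    room = ℕ.s≤s⁻¹ (+-cancelʳ-< ((2 + aC) * m) _ _ (≤-<-trans (≤-reflexive
      (trans (arith m aC z) (cong (λ e → K + e * m) (sym aq≡)))) aN-bound))
      where
      arith : ∀ m aC z → 5 + m * (7 + z) + (2 + aC) * m ≡ 5 + 3 * m + (6 + aC + z) * m
      arith = solve-∀

    suc-pred-aN : suc (aN ∸ 1) ≡ aN
    suc-pred-aN = m+[n∸m]≡n (≤-trans (s≤s z≤n) room)

    result : Approximation m
    result = record
      { b       = b
      -- One digit is given up so that `N-lower` later yields a strict bound.
      ; aN      = aN ∸ 1
      ; aC      = aC
      ; z       = z
      ; 0<b     = *-mono-≤ 0<y₁ (*-mono-≤ 0<y₂ (s≤s z≤n))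
      ; N-lower = subst (λ e → 2 ^ e ≤ N ^ b) (sym suc-pred-aN) (≤-trans (≤-reflexive (sym (*-identityʳ (2 ^ aN)))) N-lower)
      ; c-lower = ≤-trans (≤-reflexive (sym (*-identityʳ (2 ^ suc aC)))) c-lower
      ; c-upper = <-≤-trans c-upper (≤-reflexive (*-identityʳ (2 ^ (2 + aC))))
      ; x-lower = subst (λ e → 2 ^ e * T ≤ s ^ b) aq≡ x-lower
      ; x-upper = subst (λ e → s ^ b < 2 ^ suc e * T) aq≡ x-upper
      ; room    = ℕ.s≤s⁻¹ (subst (suc (m * (7 + z)) ≤_) (sym suc-pred-aN) (≤-trans (s≤s (m≤n+m (m * (7 + z)) 4)) room))
      }

  -- The denominator lies between `(3 + z) / b` and `(7 + z) / b`, the differences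
  -- `(5 + aC + z) - (2 + aC)` and `(7 + aC + z) - aC` of strict bounds. The quotient compares both
  -- with the numerator, and `room` settles the larger.
  lower : ∀ m → Approximation m → Lower Q (ιₙ m)
  lower m A =
    + aN / b , + (3 + z) / b , + (7 + z) / b ,
    lower⁺ 0<N (s≤s z≤n) (repr-ι N) aN b (below N aN N-lower) ,
    repr-<⁺ (s≤s z≤n) 0<b (repr-/ 0 1) (repr-/ (3 + z) b) (s≤s z≤n) ,
    (+ (5 + aC + z) / b , + (2 + aC) / b ,
      lower⁺ 0<s 0<t rep (5 + aC + z) b (<-≤-trans (*-monoˡ-< (t ^ b) {{ℕ.>-nonZero (^-pos b 0<t)}}
        (^-monoʳ-< 2 (s≤s (s≤s z≤n)) (n<1+n (5 + aC + z)))) x-lower) ,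
      upper⁺ 0<c (s≤s z≤n) (repr-ι c) (2 + aC) b (times-1^b {a = 2 + aC} c-upper) ,
      ℚₚ.≤-reflexive (/-sub (3 + z) (2 + aC) (5 + aC + z) (arith₁ z aC))) ,
    (+ (7 + aC + z) / b , + aC / b ,
      upper⁺ 0<s 0<t rep (7 + aC + z) b x-upper ,
      lower⁺ 0<c (s≤s z≤n) (repr-ι c) aC b (below c aC c-lower) ,
      ℚₚ.≤-reflexive (sym (/-sub (7 + z) aC (7 + aC + z) (arith₂ z aC)))) ,
    bounded (3 + z) (+-monoˡ-≤ z (s≤s (s≤s (s≤s z≤n)))) ,
    bounded (7 + z) ≤-refl
    where
    open Approximation A
    instance
      b≢0 : NonZero b
      b≢0 = ℕ.>-nonZero 0<b
    arith₁ : ∀ z aC → 3 + z + (2 + aC) ≡ 5 + aC + z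
    arith₁ = solve-∀
    arith₂ : ∀ z aC → 7 + z + aC ≡ 7 + aC + z
    arith₂ = solve-∀
    times-1^b : ∀ {y a} → y < 2 ^ a → y < 2 ^ a * 1 ^ b
    times-1^b {y} {a} = subst (y <_) (sym (trans (cong (2 ^ a *_) (^-zeroˡ b)) (*-identityʳ (2 ^ a))))
    below : ∀ y a → 2 ^ suc a ≤ y ^ b → 2 ^ a * 1 ^ b < y ^ b
    below y a le = <-≤-trans (≤-<-trans (≤-reflexive (trans (cong (2 ^ a *_) (^-zeroˡ b)) (*-identityʳ (2 ^ a))))
      (^-monoʳ-< 2 (s≤s (s≤s z≤n)) (n<1+n a))) le
    /-sub : ∀ p q p+q → p + q ≡ p+q → + p / b ≡ + p+q / b ℚ.- + q / b
    /-sub p q _ refl = ℚₚ.≤-antisym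
      (repr-≤⁺ 0<b 0<b (repr-/ p b) (repr-sub (repr-/ (p + q) b) (repr-/ q b)) ≤-refl)
      (repr-≤⁺ 0<b 0<b (repr-sub (repr-/ (p + q) b) (repr-/ q b)) (repr-/ p b) ≤-refl)
    bounded : ∀ V → V ≤ 7 + z → ιₙ m ℚ.* (+ V / b) ℚ.≤ + aN / b
    bounded V V≤ = repr-≤⁺ (*-mono-≤ {1} {1} (s≤s z≤n) 0<b) 0<b (repr-* (repr-ι m) (repr-/ V b)) (repr-/ aN b)
      (*-mono-≤ (≤-trans (*-monoʳ-≤ m V≤) room) (≤-reflexive (sym (*-identityˡ b))))

  -- `crossing` finds where `N * (c * t) ^ m ≤ s ^ m` switches from false (at 0, as `N ≥ 2`) to true
  -- (by `power-gap`). Since `c * t < s` it stays true from there on, which bounds every `j` of the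
  -- last component.
  ceiling : Positive D → ∃[ m ] IsCeiling Q (+ suc m) × (∀ j → s ^ j < N * (c * t) ^ j → j ≤ m)
  ceiling pos = m , (lower m (approximation ct<s m (≰⇒> N≰)) , ¬lower (suc m) (s≤s z≤n) N≤) , below
    where
    open ≤-Reasoning
    y = c * t
    ct<s : y < s
    ct<s = positive⇒< pos
    0<y : 0 < y
    0<y = *-mono-≤ 0<c 0<t
    large : N * y ^ (y * N) ≤ s ^ (y * N)
    large = ≤-trans (*-monoˡ-≤ (y ^ (y * N)) (<⇒≤ (n<2^n N))) (power-gap 0<y ct<s N)
    found = crossing (λ m → N * y ^ m ≤? s ^ m) (λ le → <⇒≱ 2≤N (≤-trans (≤-reflexive (sym (*-identityʳ N))) le)) (y * N) large
    m = proj₁ found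
    N≰ = proj₁ (proj₂ found)
    N≤ = proj₂ (proj₂ found)
    below : ∀ j → s ^ j < N * y ^ j → j ≤ m
    below j lt = ≮⇒≥ λ m<j → <⇒≱ lt (begin
      N * y ^ j                          ≡⟨ cong (λ e → N * y ^ e) (m+[n∸m]≡n m<j) ⟨
      N * y ^ (suc m + (j ∸ suc m))      ≡⟨ cong (N *_) (^-distribˡ-+-* y (suc m) (j ∸ suc m)) ⟩
      N * (y ^ suc m * y ^ (j ∸ suc m))  ≡⟨ *-assoc N (y ^ suc m) _ ⟨
      N * y ^ suc m * y ^ (j ∸ suc m)    ≤⟨ *-mono-≤ N≤ (^-monoˡ-≤ (j ∸ suc m) (<⇒≤ ct<s)) ⟩
      s ^ suc m * s ^ (j ∸ suc m)        ≡⟨ ^-distribˡ-+-* s (suc m) (j ∸ suc m) ⟨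
      s ^ (suc m + (j ∸ suc m))          ≡⟨ cong (s ^_) (m+[n∸m]≡n m<j) ⟩
      s ^ j                              ∎)

-- Choice of parameters and the theorem

open import Data.Nat.Divisibility using (_∣_; divides)

theorem1p3 : (r k n : ℕ) .{{_ : NonZero k}} .{{_ : NonZero n}} →
    3 ≤ r → 2 ≤ k →
    (G : RGraph r n) → Linear G →
    + (c₁ r * k) / 1 ℚ.≤ averageDegree G →
    ∃[ a ] 2 ∣ a ×
    (∀ i → i < k → LinearCycle G (a + 2 * i)) ×
    (Positive (denominator G k) →
    ∃[ m ] IsCeiling (log₂ (+ n / 1) /ᴿ denominator G k) m ×
    + a ℤ.≤ + 2 ℤ.* m)
theorem1p3 r k n 3≤r 2≤k G linear c₁k≤d = 2 * suc h
  , divides (suc h) (*-comm 2 (suc h))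
  , (λ i i<k → subst (LinearCycle G) (arith-length h i) (cycles i i<k))
  , λ positive →
      let m , isCeiling , below = ceiling positive
      in + suc m , isCeiling , subst (+ (2 * suc h) ℤ.≤_) (ℤₚ.pos-* 2 (suc m))
           -- From `h ≤ j ≤ m` follows `2 * suc h ≤ 2 * suc m`: the 1 by which the ceiling exceeds
           -- `m` pays for the shortest walk, which has two edges.
           (ℤ.+≤+ (*-monoʳ-≤ 2 (s≤s (≤-trans h≤j (below j short)))))
  where
  open ≤-Reasoning

  arith-length : ∀ h i → 2 * h + 2 * suc i ≡ 2 * suc h + 2 * i
  arith-length = solve-∀

  e p d c s t b : ℕ
  e = length (edges G)
  p = r ^ (2 * r + 2)
  -- Since `k ≥ 2`, `4 * suc k ≤ 6 * k`, so this `d` meets the demand of the walks.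
  d = 6 * (k * r)
  b = 8 * (d * (r * r))
  c = 64 * k * p
  -- `s / t` is `d(G) / k`; the factor 1 comes from multiplying the fractions `r * e / n` and
  -- `1 / k`.
  s = r * e * 1
  t = n * k

  0<r : 0 < r
  0<r = ≤-trans (s≤s z≤n) 3≤r
  0<k : 0 < k
  0<k = ≤-trans (s≤s z≤n) 2≤k
  0<n : 0 < n
  0<n = ℕ.>-nonZero⁻¹ n
  0<p : 0 < p
  0<p = ^-pos (2 * r + 2) 0<r

  dense : 128 * p * k * n ≤ e
  dense = *-cancelˡ-≤ r {{ℕ.>-nonZero 0<r}} (begin
    r * (128 * p * k * n)         ≡⟨ arith r p k n ⟩
    128 * (r * p) * k * n         ≡⟨ cong (λ q → 128 * (r ^ q) * k * n) (+-suc (2 * r) 2) ⟨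
    c₁ r * k * n                  ≤⟨ repr-≤⁻ (s≤s z≤n) 0<n (repr-/ (c₁ r * k) 1) (repr-/ (r * e) n) c₁k≤d ⟩
    r * e * 1                     ≡⟨ *-identityʳ (r * e) ⟩
    r * e                         ∎)
    where
    arith : ∀ r p k n → r * (128 * p * k * n) ≡ 128 * (r * p) * k * n
    arith = solve-∀

  0<e : 0 < e
  0<e = ≤-trans (*-mono-≤ (*-mono-≤ (*-mono-≤ {1} {128} (s≤s z≤n) 0<p) 0<k) 0<n) dense

  -- `suc δ` is `e / n` rounded up, the largest minimum degree for which the hypothesis of `core` on
  -- the number of edges holds.
  δ : ℕ
  δ = (e ∸ 1) ℕ./ n

  δ-small : n * δ < e
  δ-small = ≤-trans (s≤s (≤-trans (≤-reflexive (*-comm n δ)) (m/n*n≤m (e ∸ 1) n))) (≤-reflexive (m+[n∸m]≡n 0<e))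

  δ-large : e ≤ n * suc δ
  δ-large = begin
    e                               ≡⟨ m+[n∸m]≡n 0<e ⟨
    suc (e ∸ 1)                     ≡⟨ cong suc (m≡m%n+[m/n]*n (e ∸ 1) n) ⟩
    suc ((e ∸ 1) % n) + δ * n       ≤⟨ +-monoˡ-≤ (δ * n) (m%n<n (e ∸ 1) n) ⟩
    n + δ * n                       ≡⟨ *-comm (suc δ) n ⟩
    n * suc δ                       ∎

  min-degree : 128 * p * k ≤ suc δ
  min-degree = *-cancelˡ-≤ n (≤-trans (≤-reflexive (*-comm n (128 * p * k))) (≤-trans dense δ-large))

  r⁶≤p : r ^ 6 ≤ p
  r⁶≤p = ^-monoʳ-≤ r {{ℕ.>-nonZero 0<r}} (≤-trans (m≤m+n 6 2) (+-monoˡ-≤ 2 (*-monoʳ-≤ 2 3≤r)))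

  d-large : 4 * (suc k * r) ≤ d
  d-large = begin
    4 * (suc k * r)          ≡⟨ arith₁ k r ⟩
    (4 * k + 2 * 2) * r      ≤⟨ *-monoˡ-≤ r (+-monoʳ-≤ (4 * k) (*-monoʳ-≤ 2 2≤k)) ⟩
    (4 * k + 2 * k) * r      ≡⟨ arith₂ k r ⟩
    6 * (k * r)              ∎
    where
    arith₁ : ∀ k r → 4 * (suc k * r) ≡ (4 * k + 2 * 2) * r
    arith₁ = solve-∀
    arith₂ : ∀ k r → (4 * k + 2 * k) * r ≡ 6 * (k * r)
    arith₂ = solve-∀

  -- Here `c₁` enters: the left side is `144 * k * r ^ 5`, which is at most `48 * k * r ^ 6` as
  -- `r ≥ 3`, hence at most `128 * p * k`.
  threshold : 24 * (d * (r * r * (r * r))) ≤ suc δ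
  threshold = begin
    24 * (d * (r * r * (r * r)))    ≡⟨ arith₁ k r ⟩
    k * (48 * (3 * r ^ 5))          ≤⟨ *-monoʳ-≤ k (*-mono-≤ (m≤m+n 48 80) (≤-trans (*-monoˡ-≤ (r ^ 5) 3≤r) r⁶≤p)) ⟩
    k * (128 * p)                   ≡⟨ *-comm k (128 * p) ⟩
    128 * p * k                     ≤⟨ min-degree ⟩
    suc δ                           ∎
    where
    arith₁ : ∀ k r → 24 * (6 * (k * r) * (r * r * (r * r))) ≡ k * (48 * (3 * (r * (r * (r * (r * (r * 1)))))))
    arith₁ = solve-∀

  result = core {r} {n} (≤-trans (s≤s (s≤s z≤n)) 3≤r) G linear k d δ d-large threshold δ-small
  j = proj₁ result
  h = proj₁ (proj₂ result)
  0<h : 0 < h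
  0<h = proj₁ (proj₂ (proj₂ result))
  h≤j : h ≤ j
  h≤j = proj₁ (proj₂ (proj₂ (proj₂ result)))
  cycles : ∀ i → i < k → LinearCycle G (2 * h + 2 * suc i)
  cycles = proj₁ (proj₂ (proj₂ (proj₂ (proj₂ result))))
  growth : suc δ ^ j ≤ b ^ j * n
  growth = proj₂ (proj₂ (proj₂ (proj₂ (proj₂ result))))

  -- Here `c₂` enters: a sparse level multiplies the top by at least `suc δ / b ≥ s / (r * n * b)`,
  -- and this inequality makes that exceed `s / (c * t)`.
  base : r * n * b < c * t
  base = begin-strict
    r * n * b                        ≡⟨ arith₁ r n k ⟩
    48 * (k * n * (r * r * (r * r))) <⟨ *-monoˡ-< _ {{ℕ.>-nonZero (*-mono-≤ (*-mono-≤ 0<k 0<n) (*-mono-≤ (*-mono-≤ 0<r 0<r) (*-mono-≤ 0<r 0<r)))}} (m≤m+n 49 15) ⟩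
    64 * (k * n * (r * r * (r * r))) ≤⟨ *-monoʳ-≤ 64 (*-monoʳ-≤ (k * n) r⁴≤) ⟩
    64 * (k * n * (p * k))           ≡⟨ arith₂ k n p ⟩
    c * t                            ∎
    where
    arith₁ : ∀ r n k → r * n * (8 * (6 * (k * r) * (r * r))) ≡ 48 * (k * n * (r * r * (r * r)))
    arith₁ = solve-∀
    arith₂ : ∀ k n p → 64 * (k * n * (p * k)) ≡ 64 * k * p * (n * k)
    arith₂ = solve-∀
    arith₃ : ∀ r → r * r * (r * r) ≡ r * (r * (r * (r * 1)))
    arith₃ = solve-∀
    r⁴≤ : r * r * (r * r) ≤ p * k
    r⁴≤ = begin
      r * r * (r * r)   ≡⟨ arith₃ r ⟩
      r ^ 4             ≤⟨ ^-monoʳ-≤ r {{ℕ.>-nonZero 0<r}} (m≤m+n 4 2) ⟩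
      r ^ 6             ≤⟨ r⁶≤p ⟩
      p                 ≡⟨ *-identityʳ p ⟨
      p * 1             ≤⟨ *-monoʳ-≤ p 0<k ⟩
      p * k             ∎

  short : s ^ j < n * (c * t) ^ j
  short = begin-strict
    (r * e * 1) ^ j              ≡⟨ cong (_^ j) (*-identityʳ (r * e)) ⟩
    (r * e) ^ j                  ≤⟨ ^-monoˡ-≤ j (*-monoʳ-≤ r δ-large) ⟩
    (r * (n * suc δ)) ^ j        ≡⟨ cong (_^ j) (*-assoc r n (suc δ)) ⟨
    (r * n * suc δ) ^ j          ≡⟨ ^-distribʳ-* j (r * n) (suc δ) ⟩
    (r * n) ^ j * suc δ ^ j      ≤⟨ *-monoʳ-≤ ((r * n) ^ j) growth ⟩
    (r * n) ^ j * (b ^ j * n)    ≡⟨ *-assoc ((r * n) ^ j) (b ^ j) n ⟨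
    (r * n) ^ j * b ^ j * n      ≡⟨ cong (_* n) (^-distribʳ-* j (r * n) b) ⟨
    -- Strictness survives the power because `0 < h ≤ j`.
    (r * n * b) ^ j * n          <⟨ *-monoˡ-< n (^-monoˡ-< j {{ℕ.>-nonZero (≤-trans 0<h h≤j)}} base) ⟩
    (c * t) ^ j * n              ≡⟨ *-comm ((c * t) ^ j) n ⟩
    n * (c * t) ^ j              ∎

  2≤n : 2 ≤ n
  2≤n = ≤-trans (≤-trans (s≤s (s≤s z≤n)) 3≤r) (r≤n (LinearCycle.3≤ℓ cycle) (LinearCycle.edge cycle) (LinearCycle.edge∈ cycle))
    where
    cycle = cycles 0 0<k
    r≤n : ∀ {ℓ} → 3 ≤ ℓ → (edge : Fin ℓ → Subset n) → (∀ i → edge i ∈ edges G) → r ≤ n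
    r≤n {suc ℓ} _ edge edge∈ = ≤-trans (≤-reflexive (sym (All.lookup (uniform G) (edge∈ zero)))) (Subsetₚ.∣p∣≤n (edge zero))

  open LogQuotient {averageDegree G ℚ.* (+ 1 / k)} {s} {t} {c} {n}
    (*-mono-≤ (*-mono-≤ 0<r 0<e) (s≤s z≤n)) (*-mono-≤ 0<n 0<k)
    (repr-* (repr-/ (r * e) n) (repr-/ 1 k))
    (*-mono-≤ {2} {64 * k} (*-mono-≤ {2} {64} (s≤s (s≤s z≤n)) 0<k) 0<p) 2≤n
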